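{- Let $t$ be a positive integer. (a) Assume $3t(t+1)$ is not of the form $l(l+1)$ for any $l\in\mathbb{N}$. Then the interval $[12t-1,\,6t(t+1)-1]$ contains an integer $n\equiv 3\pmod 4$ with $a_3^+(n)$ odd. (b) Assume $6t(2t+1)$ is not of the form $l(l+1)$ for any $l\in\mathbb{N}$. Then the interval $[24t-1,\,12t(2t+1)-1]$ contains an integer $n\equiv 3\pmod 4$ with $a_3^+(n)$ even. In particular, there are infinitely many integers $n\equiv 3\pmod 4$ for which $c_3^+(n)$ is even, and infinitely many integers $n\equiv 3\pmod 4$ for which $c_3^+(n)$ is odd.
   Context: Let $q=e^{2\pi i z}$ with $z$ in the upper half-plane, and $\eta(z)=q^{1/24}\prod_{n\ge1}(1-q^n)$. Define $f_3^+(z)=\left(\frac{\eta(z)}{\eta(3z)}\right)^{12}=\sum_{n\ge -1}a_3^+(n)q^n$ (so $a_3^+(n)=0$ for $n<-1$ and $a_3^+(-1)=1$). Define $j_3^+(z)=\left(\frac{\eta(z)}{\eta(3z)}\right)^{12}+12+3^6\left(\frac{\eta(3z)}{\eta(z)}\right)^{12}$ and let $c_3^+(n)$ be the coefficient of $q^n$ in its $q$-expansion. -}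

module Defs where

open import Data.Nat as ℕ using (ℕ; zero; suc; _∸_)
open import Data.Nat.Divisibility using (_∣?_)
open import Data.Integer as ℤ using (ℤ; +_; -[1+_]; 0ℤ; 1ℤ; -1ℤ)
open import Data.List using (List; foldr; map; upTo)
open import Data.Bool using (Bool; if_then_else_)
open import Relation.Nullary using (does)

Series : Set
Series = ℕ → ℤ

_⊛_ : Series → Series → Series
(f ⊛ g) m = foldr ℤ._+_ 0ℤ (map (λ i → f i ℤ.* g (m ∸ i)) (upTo (suc m)))

oneS : Series
oneS zero    = 1ℤ
oneS (suc _) = 0ℤ

_^S_ : Series → ℕ → Series
f ^S zero  = oneS
f ^S suc n = f ⊛ (f ^S n)

-- the series 1 - q^k  (for k ≥ 1)
oneMinusQ : ℕ → Series
oneMinusQ k zero = 1ℤ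
oneMinusQ k (suc m) = if does (k ℕ.≟ suc m) then -1ℤ else 0ℤ

-- the series 1/(1 - q^k) = Σ_{j≥0} q^{kj}  (for k ≥ 1)
geom : ℕ → Series
geom k m = if does (k ∣? m) then 1ℤ else 0ℤ

prodTo : ℕ → (ℕ → Series) → Series
prodTo zero    F = oneS
prodTo (suc N) F = F (suc N) ⊛ prodTo N F

factorA : ℕ → Series
factorA k = (oneMinusQ k ^S 12) ⊛ (geom (3 ℕ.* k) ^S 12)

factorB : ℕ → Series
factorB k = (oneMinusQ (3 ℕ.* k) ^S 12) ⊛ (geom k ^S 12)

-- coefficient of q^m of the infinite product ∏_{k≥1} F k (each F k ≡ 1 mod q^k),
-- computed exactly by the finite product over k ≤ m
infProdCoeff : (ℕ → Series) → ℕ → ℤ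
infProdCoeff F m = prodTo m F m

shiftedCoeff : ℤ → (ℕ → ℤ) → ℤ → ℤ
shiftedCoeff s P n with n ℤ.- s
... | + m      = P m
... | -[1+ _ ] = 0ℤ

-- a₃⁺(n): coefficient of q^n in (η(z)/η(3z))^12 = q^{-1} ∏ (1-q^k)^12/(1-q^{3k})^12
a3+ : ℤ → ℤ
a3+ = shiftedCoeff -1ℤ (infProdCoeff factorA)

-- coefficient of q^n in (η(3z)/η(z))^12 = q ∏ (1-q^{3k})^12/(1-q^k)^12
b3+ : ℤ → ℤ
b3+ = shiftedCoeff 1ℤ (infProdCoeff factorB)

const12 : ℤ → ℤ
const12 (+ zero) = + 12
const12 _        = 0ℤ

-- c₃⁺(n): coefficient of q^n in j₃⁺ = (η(z)/η(3z))^12 + 12 + 3^6 (η(3z)/η(z))^12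
c3+ : ℤ → ℤ
c3+ n = a3+ n ℤ.+ const12 n ℤ.+ (+ 729) ℤ.* b3+ n

{-# OPTIONS --safe #-}
module Submission where

-- Write T_l = l(l+1)/2 and ψ(q) = Σ_l q^T_l. Modulo 2, Gauss' product formula for ψ
-- gives ∏ (1-q^k)^3 ≡ ψ(q), hence ∏ (1-q^k)^12 ≡ ψ(q^4) and, with
-- A = ∏ (1-q^k)^12 / (1-q^{3k})^12 = q (η(z)/η(3z))^12,  A ψ(q^12) ≡ ψ(q^4).
-- If 3 T_t is not triangular, the coefficient of q^(12 T_t) on the right vanishes, so
-- the t+1 numbers a₃⁺(12(T_t - T_l) - 1), 0 ≤ l ≤ t, have even sum; the one with l = t is
-- 1. Hence some l < t gives an odd value, and if t is even then not all l < t do.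
-- For n ≡ 3 mod 4, b₃⁺(n) is even because (η(3z)/η(z))^12 / q is modulo 2 a fourth power,
-- i.e. a series in q^4; so c₃⁺(n) ≡ a₃⁺(n), and 3t(t+1) ≡ 3 mod 5 is never l(l+1)
-- when t ≡ 2 mod 5.

open import Defs
open import Algebra using (CommutativeSemiring; IsCommutativeSemiring; RawRing)
import Algebra.Properties.CommutativeSemigroup
import Algebra.Properties.CommutativeSemiring.Exp
import Algebra.Properties.Semiring.Exp
import Algebra.Solver.Ring
open import Algebra.Solver.Ring.AlmostCommutativeRing using (_-Raw-AlmostCommutative⟶_; fromCommutativeSemiring)
import Algebra.Structures.Biased
open import Data.Bool using (Bool; true; false; _xor_; _∧_; if_then_else_)
import Data.Bool as Bool
import Data.Integer as ℤ
import Data.Integer.DivMod as ℤ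
import Data.Integer.Divisibility.Signed as Signed
import Data.Integer.Properties as ℤ
import Data.Integer.Tactic.RingSolver as ℤ
open import Data.Integer using (ℤ; 0ℤ; 1ℤ; -1ℤ; +_)
open import Data.List using (foldr)
open import Data.List.Properties using (map-upTo; map-applyUpTo)
import Data.Maybe as Maybe
import Data.Nat as ℕ
import Data.Nat.DivMod as ℕ
import Data.Nat.Divisibility as ℕ
import Data.Nat.Properties as ℕ
import Data.Nat.Solver as ℕ
open import Data.Nat using (ℕ; zero; suc; _≤_; _<_; z≤n; s≤s)
open import Data.Product using (Σ; ∃; _×_; _,_)
open import Data.Sum using (_⊎_; inj₁; inj₂)
open import Function using (_∘_)
open import Level using (Level; 0ℓ)
open import Relation.Binary using (Setoid; IsEquivalence)
open import Relation.Binary.Consequences using (dec⇒weaklyDec)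
open import Relation.Binary.PropositionalEquality as ≡ using (_≡_; _≢_; cong; cong₂)
import Relation.Binary.Reasoning.Setoid
open import Relation.Nullary using (¬_; does; yes; no; contradiction)
open import Relation.Nullary.Decidable using (dec-false)

-- Gauss' identity in characteristic two

-- Infinite products and theta series would call for limits. Instead all identities are read modulo
-- (2, q^(N+1)): there q is nilpotent, and finite products and sums already carry every coefficient
-- up to q^N. Gauss' formula is ψ(q) = ∏ (1-q^(2k))^2 / (1-q^k). Modulo 2 its numerator is ∏
-- (1-q^k)^4, whence the cube; the exponent 12 = 4 · 3 then comes from Frobenius, f(q)^4 ≡ f(q^4).
-- The formula itself is derived from a finite identity of Shanks, proved by induction in any
-- commutative semiring with 1 + 1 ≈ 0 that contains the required inverses. Signs disappear there,
-- and a power of q may be substituted for x, which yields ψ(q^4) and ψ(q^12) from one argument.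

tri : ℕ → ℕ
tri zero    = zero
tri (suc l) = suc l ℕ.+ tri l

2*tri : ∀ l → 2 ℕ.* tri l ≡ l ℕ.* (l ℕ.+ 1)
2*tri zero    = ≡.refl
2*tri (suc l) = begin
  2 ℕ.* (suc l ℕ.+ tri l)            ≡⟨ ℕ.*-distribˡ-+ 2 (suc l) (tri l) ⟩
  2 ℕ.* suc l ℕ.+ 2 ℕ.* tri l        ≡⟨ ≡.cong (2 ℕ.* suc l ℕ.+_) (2*tri l) ⟩
  2 ℕ.* suc l ℕ.+ l ℕ.* (l ℕ.+ 1)    ≡⟨ solve 1 (λ l → con 2 :* (con 1 :+ l) :+ l :* (l :+ con 1)
                                                := (con 1 :+ l) :* (con 1 :+ l :+ con 1)) ≡.refl l ⟩
  suc l ℕ.* (suc l ℕ.+ 1)            ∎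
  where
  open ≡.≡-Reasoning
  open ℕ.+-*-Solver

tri-double : ∀ n → tri (2 ℕ.* n) ≡ n ℕ.* (1 ℕ.+ 2 ℕ.* n)
tri-double n = ℕ.*-cancelˡ-≡ _ _ 2 (≡.trans (2*tri (2 ℕ.* n))
  (solve 1 (λ n → con 2 :* n :* (con 2 :* n :+ con 1) := con 2 :* (n :* (con 1 :+ con 2 :* n))) ≡.refl n))
  where open ℕ.+-*-Solver

-- Finite sums and products in a commutative semiring.

module FiniteSums {c ℓ : Level} (S : CommutativeSemiring c ℓ) where
  open CommutativeSemiring S
  open Algebra.Properties.Semiring.Exp semiring
  open Algebra.Properties.CommutativeSemiring.Exp S using (^-distrib-*)
  open Algebra.Properties.CommutativeSemigroup *-commutativeSemigroup using (interchange)
  open Relation.Binary.Reasoning.Setoid setoid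

  -- ∏ ranges over 1, …, n and ∑ over 0, …, n ∸ 1.
  ∏ ∑ : ℕ → (ℕ → Carrier) → Carrier
  ∏ zero    F = 1#
  ∏ (suc n) F = F (suc n) * ∏ n F
  ∑ zero    F = 0#
  ∑ (suc n) F = F n + ∑ n F

  ∏-cong : ∀ {F G} → (∀ k → F (suc k) ≈ G (suc k)) → ∀ n → ∏ n F ≈ ∏ n G
  ∏-cong F≈G zero    = refl
  ∏-cong F≈G (suc n) = *-cong (F≈G n) (∏-cong F≈G n)

  ∏-1 : ∀ {F} → (∀ k → F (suc k) ≈ 1#) → ∀ n → ∏ n F ≈ 1#
  ∏-1 F≈1 zero    = refl
  ∏-1 F≈1 (suc n) = trans (*-cong (F≈1 n) (∏-1 F≈1 n)) (*-identityˡ 1#)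

  ∏-* : ∀ F G n → ∏ n (λ k → F k * G k) ≈ ∏ n F * ∏ n G
  ∏-* F G zero    = sym (*-identityˡ 1#)
  ∏-* F G (suc n) = trans (*-congˡ (∏-* F G n)) (interchange _ _ _ _)

  1^ : ∀ m → 1# ^ m ≈ 1#
  1^ zero    = refl
  1^ (suc m) = trans (*-identityˡ _) (1^ m)

  ∏-^ : ∀ F m n → ∏ n (λ k → F k ^ m) ≈ ∏ n F ^ m
  ∏-^ F m zero    = sym (1^ m)
  ∏-^ F m (suc n) = trans (*-congˡ (∏-^ F m n)) (sym (^-distrib-* _ _ m))

  ∏-truncate : ∀ {F} n → (∀ k → n < k → F k ≈ 1#) → ∀ d → ∏ (d ℕ.+ n) F ≈ ∏ n F
  ∏-truncate n F≈1 zero    = refl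
  ∏-truncate n F≈1 (suc d) = trans
    (*-cong (F≈1 (suc d ℕ.+ n) (ℕ.s≤s (ℕ.m≤n+m n d))) (∏-truncate n F≈1 d)) (*-identityˡ _)

  ∑-cong : ∀ {F G} → (∀ k → F k ≈ G k) → ∀ n → ∑ n F ≈ ∑ n G
  ∑-cong F≈G zero    = refl
  ∑-cong F≈G (suc n) = +-cong (F≈G n) (∑-cong F≈G n)

  ∑-truncate : ∀ {F} n → (∀ k → n ≤ k → F k ≈ 0#) → ∀ d → ∑ (d ℕ.+ n) F ≈ ∑ n F
  ∑-truncate n F≈0 zero    = refl
  ∑-truncate n F≈0 (suc d) = trans
    (+-cong (F≈0 (d ℕ.+ n) (ℕ.m≤n+m n d)) (∑-truncate n F≈0 d)) (+-identityˡ _)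

  *-distribˡ-∑ : ∀ a F n → a * ∑ n F ≈ ∑ n (λ k → a * F k)
  *-distribˡ-∑ a F zero    = zeroʳ a
  *-distribˡ-∑ a F (suc n) = trans (distribˡ a _ _) (+-congˡ (*-distribˡ-∑ a F n))

module CharacteristicTwo {c ℓ : Level} (S : CommutativeSemiring c ℓ)
  (1+1≈0 : CommutativeSemiring._≈_ S (CommutativeSemiring._+_ S (CommutativeSemiring.1# S) (CommutativeSemiring.1# S))
    (CommutativeSemiring.0# S)) where

  open CommutativeSemiring S
  open FiniteSums S
  open Algebra.Properties.Semiring.Exp semiring
  open Algebra.Properties.CommutativeSemiring.Exp S using (^-distrib-*)
  open Relation.Binary.Reasoning.Setoid setoid

  private
    -- Coefficients in 𝔽₂ let the solver's normal forms absorb 1 + 1 ≈ 0.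
    𝔽₂ : RawRing _ _
    𝔽₂ = record
      { Carrier = Bool ; _≈_ = _≡_ ; _+_ = _xor_ ; _*_ = _∧_ ; -_ = λ b → b ; 0# = false ; 1# = true }

    embed : Bool → Carrier
    embed b = if b then 1# else 0#

    embed-homomorphism : 𝔽₂ -Raw-AlmostCommutative⟶ fromCommutativeSemiring S
    embed-homomorphism = record
      { ⟦_⟧    = embed
      ; +-homo = λ where
          false b     → sym (+-identityˡ (embed b))
          true  false → sym (+-identityʳ 1#)
          true  true  → sym 1+1≈0
      ; *-homo = λ where
          false b → sym (zeroˡ (embed b))
          true  b → sym (*-identityˡ (embed b))
      ; -‿homo = λ _ → refl
      ; 0-homo = refl
      ; 1-homo = refl
      }

  open Algebra.Solver.Ring 𝔽₂ (fromCommutativeSemiring S) embed-homomorphism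
    (λ a b → Maybe.map (λ a≡b → reflexive (≡.cong embed a≡b)) (dec⇒weaklyDec Bool._≟_ a b))

  ^-vanish : ∀ {x m n} → x ^ m ≈ 0# → m ≤ n → x ^ n ≈ 0#
  ^-vanish {x} {m} {n} xᵐ≈0 m≤n = begin
    x ^ n                       ≡⟨ ≡.cong (x ^_) (ℕ.m+[n∸m]≡n m≤n) ⟨
    x ^ (m ℕ.+ (n ℕ.∸ m))       ≈⟨ ^-homo-* x m _ ⟩
    x ^ m * x ^ (n ℕ.∸ m)       ≈⟨ *-congʳ xᵐ≈0 ⟩
    0# * x ^ (n ℕ.∸ m)          ≈⟨ zeroˡ _ ⟩
    0#                          ∎

  -- Frobenius applied twice: the middle binomial coefficients 4, 6, 4 vanish in the solver's 𝔽₂.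
  [1+x]⁴ : ∀ x → (1# + x) ^ 4 ≈ 1# + x ^ 4
  [1+x]⁴ = solve 1 (λ x → let y = con true :+ x in
    y :* (y :* (y :* (y :* con true))) := con true :+ x :* (x :* (x :* (x :* con true)))) refl

  -- Shanks' finite form of Gauss' identity ∑ xᵗʳⁱ⁽ˡ⁾ = ∏ (1 - x²ʳ) / (1 - x²ʳ⁻¹), with the signs
  -- dropped. For nilpotent x all but the first summand of shanks vanish, so that no limit is needed.
  module Gauss (x : Carrier) (u : ℕ → Carrier) (u-inverse : ∀ k → (1# + x ^ suc k) * u k ≈ 1#) where

    φ : ℕ → Carrier
    φ n = ∏ n (λ k → 1# + x ^ k)

    ψ : ℕ → Carrier
    ψ m = ∑ m (λ l → x ^ tri l)

    -- The subscripts stand for odd and even exponents. As `u k` inverts the factor with exponent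
    -- `suc k`, `u (2 * n)` belongs to x^(2n+1) and `u (1 + 2 * n)` to x^(2n+2).
    φₒ φₑ φₒ⁻¹ φₒ/φₑ : ℕ → Carrier
    φₒ zero       = 1#
    φₒ (suc n)    = (1# + x ^ (1 ℕ.+ 2 ℕ.* n)) * φₒ n
    φₑ zero       = 1#
    φₑ (suc n)    = (1# + x ^ (2 ℕ.+ 2 ℕ.* n)) * φₑ n
    φₒ⁻¹ zero     = 1#
    φₒ⁻¹ (suc n)  = u (2 ℕ.* n) * φₒ⁻¹ n
    φₒ/φₑ zero    = 1#
    φₒ/φₑ (suc n) = (1# + x ^ (1 ℕ.+ 2 ℕ.* n)) * u (1 ℕ.+ 2 ℕ.* n) * φₒ/φₑ n

    φₒ-inverse : ∀ n → φₒ n * φₒ⁻¹ n ≈ 1#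
    φₒ-inverse zero    = *-identityˡ 1#
    φₒ-inverse (suc n) = begin
      (1# + y) * φₒ n * (u (2 ℕ.* n) * φₒ⁻¹ n)
        ≈⟨ solve 4 (λ y o u v → (con true :+ y) :* o :* (u :* v) := (con true :+ y) :* u :* (o :* v)) refl _ _ _ _ ⟩
      (1# + y) * u (2 ℕ.* n) * (φₒ n * φₒ⁻¹ n)  ≈⟨ *-cong (u-inverse _) (φₒ-inverse n) ⟩
      1# * 1#                                   ≈⟨ *-identityˡ 1# ⟩
      1#                                        ∎
      where y = x ^ (1 ℕ.+ 2 ℕ.* n)

    φₑ*φₒ/φₑ : ∀ n → φₑ n * φₒ/φₑ n ≈ φₒ n
    φₑ*φₒ/φₑ zero    = *-identityˡ 1#
    φₑ*φₒ/φₑ (suc n) = begin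
      (1# + x * y) * φₑ n * ((1# + y) * v * φₒ/φₑ n)
        ≈⟨ solve 5 (λ x y e v o → (con true :+ x :* y) :* e :* ((con true :+ y) :* v :* o)
             := (con true :+ x :* y) :* v :* ((con true :+ y) :* (e :* o))) refl _ _ _ _ _ ⟩
      (1# + x * y) * v * ((1# + y) * (φₑ n * φₒ/φₑ n))  ≈⟨ *-cong (u-inverse _) (*-congˡ (φₑ*φₒ/φₑ n)) ⟩
      1# * ((1# + y) * φₒ n)                            ≈⟨ *-identityˡ _ ⟩
      (1# + y) * φₒ n                                   ∎
      where
      y = x ^ (1 ℕ.+ 2 ℕ.* n)
      v = u (1 ℕ.+ 2 ℕ.* n)

    -- With P(n) = ∏ (1-x^(2r)) / (1-x^(2r-1)) over r ≤ n, Shanks' sum is ∑ P(n)/P(s) x^(s(2n+1))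
    -- over s < n; here P(n) is taken out. The length `m` is independent of `n` so that the sums for
    -- `n` and `suc n` can be compared at equal length.
    shanks : ℕ → ℕ → Carrier
    shanks n m = ∑ m (λ s → φₒ/φₑ s * x ^ (s ℕ.* (1 ℕ.+ 2 ℕ.* n)))

    private
      exponent-step : ∀ n s → x ^ (s ℕ.* (1 ℕ.+ 2 ℕ.* suc n)) ≈ x ^ (s ℕ.* (1 ℕ.+ 2 ℕ.* n)) * x ^ (2 ℕ.* s)
      exponent-step n s = trans (^-congʳ x (solveℕ n s)) (^-homo-* x (s ℕ.* (1 ℕ.+ 2 ℕ.* n)) (2 ℕ.* s))
        where
        open ℕ.+-*-Solver renaming (solve to solve′; _:*_ to _⊗_; _:+_ to _⊕_; _:=_ to _⊜_; con to c′)
        solveℕ : ∀ n s → s ℕ.* (1 ℕ.+ 2 ℕ.* suc n) ≡ s ℕ.* (1 ℕ.+ 2 ℕ.* n) ℕ.+ 2 ℕ.* s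
        solveℕ = solve′ 2 (λ n s → s ⊗ (c′ 1 ⊕ c′ 2 ⊗ (c′ 1 ⊕ n)) ⊜ s ⊗ (c′ 1 ⊕ c′ 2 ⊗ n) ⊕ c′ 2 ⊗ s) ≡.refl

    -- The right side G(m) is a discrete antiderivative: G(m) + G(m+1) is the contribution of s = m
    -- to the left side, and G(0) contains the factor 1 + 1 ≈ 0.
    shanks-telescope : ∀ n m →
      (1# + x ^ (2 ℕ.+ 2 ℕ.* n)) * shanks (suc n) m + (1# + x ^ (1 ℕ.+ 2 ℕ.* n)) * shanks n m
        ≈ φₒ/φₑ m * ((1# + x ^ (2 ℕ.* m)) * x ^ (m ℕ.* (1 ℕ.+ 2 ℕ.* n)))
    shanks-telescope n zero = solve 2 (λ x y → (con true :+ x :* y) :* con false :+ (con true :+ y) :* con false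
        := con true :* ((con true :+ con true) :* con true)) refl x (x ^ (1 ℕ.+ 2 ℕ.* n))
    shanks-telescope n (suc m) = begin
      (1# + x * y) * (v * x ^ (m ℕ.* (1 ℕ.+ 2 ℕ.* suc n)) + b′) + (1# + y) * (v * e + b)
        ≈⟨ +-congʳ (*-congˡ (+-congʳ (*-congˡ (exponent-step n m)))) ⟩
      (1# + x * y) * (v * (e * z) + b′) + (1# + y) * (v * e + b)
        ≈⟨ solve 7 (λ x y v e z b b′ →
             (con true :+ x :* y) :* (v :* (e :* z) :+ b′) :+ (con true :+ y) :* (v :* e :+ b)
             := ((con true :+ x :* y) :* b′ :+ (con true :+ y) :* b)
                :+ ((con true :+ x :* y) :* (v :* (e :* z)) :+ (con true :+ y) :* (v :* e)))
             refl x y v e z b b′ ⟩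
      ((1# + x * y) * b′ + (1# + y) * b) + ((1# + x * y) * (v * (e * z)) + (1# + y) * (v * e))
        ≈⟨ +-congʳ (shanks-telescope n m) ⟩
      v * ((1# + z) * e) + ((1# + x * y) * (v * (e * z)) + (1# + y) * (v * e))
        ≈⟨ solve 5 (λ x y v e z →
             v :* ((con true :+ z) :* e) :+ ((con true :+ x :* y) :* (v :* (e :* z)) :+ (con true :+ y) :* (v :* e))
             := con true :* ((con true :+ x :* z) :* v :* (y :* e)))
             refl x y v e z ⟩
      -- Expanding the 1 as (1 + x^(2m+2)) w supplies both the inverse that completes
      -- `φₒ/φₑ (suc m)` and the factor 1 + x^(2(m+1)) of G(m+1).
      1# * ((1# + x * z) * v * (y * e))
        ≈⟨ *-congʳ (u-inverse (1 ℕ.+ 2 ℕ.* m)) ⟨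
      (1# + x * (x * z)) * w * ((1# + x * z) * v * (y * e))
        ≈⟨ solve 6 (λ x y v e z w →
             (con true :+ x :* (x :* z)) :* w :* ((con true :+ x :* z) :* v :* (y :* e))
             := (con true :+ x :* z) :* w :* v :* ((con true :+ x :* (x :* z)) :* (y :* e)))
             refl x y v e z w ⟩
      (1# + x * z) * w * v * ((1# + x * (x * z)) * (y * e))
        ≈⟨ *-congˡ (*-cong (+-congˡ (^-congʳ x (ℕ.*-suc 2 m))) (^-homo-* x (1 ℕ.+ 2 ℕ.* n) _)) ⟨
      (1# + x * z) * w * v * ((1# + x ^ (2 ℕ.* suc m)) * x ^ (suc m ℕ.* (1 ℕ.+ 2 ℕ.* n))) ∎
      where
      y = x ^ (1 ℕ.+ 2 ℕ.* n)
      z = x ^ (2 ℕ.* m)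
      e = x ^ (m ℕ.* (1 ℕ.+ 2 ℕ.* n))
      v = φₒ/φₑ m
      w = u (1 ℕ.+ 2 ℕ.* m)
      b = shanks n m
      b′ = shanks (suc n) m

    -- From n to n+1, ψ gains the exponents T_(2n) = n(2n+1) and T_(2n+1), and the Shanks sum gains
    -- the summand s = n; the telescoping relation at m = n accounts for the change of n in the
    -- older summands.
    shanks-identity : ∀ n → φₒ n * ψ (2 ℕ.* n) ≈ φₑ n * shanks n n
    shanks-identity zero    = refl
    shanks-identity (suc n) = begin
      (1# + y) * o * ψ (2 ℕ.* suc n)           ≡⟨ ≡.cong (λ k → (1# + y) * o * ψ k) (ℕ.*-suc 2 n) ⟩
      (1# + y) * o * (x ^ tri (1 ℕ.+ 2 ℕ.* n) + (x ^ tri (2 ℕ.* n) + p))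
        ≈⟨ *-congˡ (+-cong (trans (^-homo-* x (1 ℕ.+ 2 ℕ.* n) _) (*-congˡ tri≈f)) (+-congʳ tri≈f)) ⟩
      (1# + y) * o * (y * f + (f + p))
        -- Since y = x z, (1+y)^2 = 1 + y^2 = (1+z) + (1+xy) z. The piece 1+z feeds the telescoping
        -- boundary term, the other one is the new summand s = n.
        ≈⟨ solve 5 (λ x z o f p → let y = x :* z in
             (con true :+ y) :* o :* (y :* f :+ (f :+ p))
             := o :* ((con true :+ z) :* f) :+ ((con true :+ y) :* (o :* p) :+ (con true :+ x :* y) :* o :* (f :* z)))
             refl x z o f p ⟩
      o * ((1# + z) * f) + ((1# + y) * (o * p) + (1# + x * y) * o * (f * z))
        ≈⟨ +-cong (*-congʳ (φₑ*φₒ/φₑ n)) (+-cong (*-congˡ (sym (shanks-identity n)))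
             (*-congʳ (*-congˡ (φₑ*φₒ/φₑ n)))) ⟨
      e * v * ((1# + z) * f) + ((1# + y) * (e * b) + (1# + x * y) * (e * v) * (f * z))
        ≈⟨ +-congʳ (*-assoc e v _) ⟩
      e * (v * ((1# + z) * f)) + ((1# + y) * (e * b) + (1# + x * y) * (e * v) * (f * z))
        ≈⟨ +-congʳ (*-congˡ (shanks-telescope n n)) ⟨
      e * ((1# + x * y) * b′ + (1# + y) * b) + ((1# + y) * (e * b) + (1# + x * y) * (e * v) * (f * z))
        ≈⟨ solve 7 (λ x z e v f b b′ → let y = x :* z in
             e :* ((con true :+ x :* y) :* b′ :+ (con true :+ y) :* b)
               :+ ((con true :+ y) :* (e :* b) :+ (con true :+ x :* y) :* (e :* v) :* (f :* z))
             := (con true :+ x :* y) :* e :* (v :* (f :* z) :+ b′))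
             refl x z e v f b b′ ⟩
      (1# + x * y) * e * (v * (f * z) + b′)
        ≈⟨ *-congˡ (+-congʳ (*-congˡ (exponent-step n n))) ⟨
      (1# + x * y) * e * (v * x ^ (n ℕ.* (1 ℕ.+ 2 ℕ.* suc n)) + b′) ∎
      where
      z = x ^ (2 ℕ.* n)
      y = x * z
      f = x ^ (n ℕ.* (1 ℕ.+ 2 ℕ.* n))
      o = φₒ n
      e = φₑ n
      v = φₒ/φₑ n
      p = ψ (2 ℕ.* n)
      b = shanks n n
      b′ = shanks (suc n) n
      tri≈f : x ^ tri (2 ℕ.* n) ≈ f
      tri≈f = ^-congʳ x (tri-double n)

    -- Frobenius in each factor: 1 + x^(2k) = (1 + x^k)^2.
    φₑ≈φ² : ∀ n → φₑ n ≈ φ n * φ n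
    φₑ≈φ² zero    = sym (*-identityˡ 1#)
    φₑ≈φ² (suc n) = begin
      (1# + x ^ (2 ℕ.+ 2 ℕ.* n)) * φₑ n      ≡⟨ ≡.cong (λ k → (1# + x ^ k) * φₑ n) 2+2n ⟩
      (1# + x ^ (suc n ℕ.+ suc n)) * φₑ n    ≈⟨ *-cong (+-congˡ (^-homo-* x (suc n) (suc n))) (φₑ≈φ² n) ⟩
      (1# + y * y) * (φ n * φ n)             ≈⟨ solve 2 (λ y f → (con true :+ y :* y) :* (f :* f)
                                                  := (con true :+ y) :* f :* ((con true :+ y) :* f)) refl y (φ n) ⟩
      (1# + y) * φ n * ((1# + y) * φ n)      ∎
      where
      y = x ^ suc n
      2+2n : 2 ℕ.+ 2 ℕ.* n ≡ suc n ℕ.+ suc n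
      2+2n = ≡.trans (≡.sym (ℕ.*-suc 2 n)) (≡.cong (suc n ℕ.+_) (ℕ.+-identityʳ (suc n)))

    φₒ*φₑ : ∀ n → φₒ n * φₑ n ≈ φ (2 ℕ.* n)
    φₒ*φₑ zero    = *-identityˡ 1#
    φₒ*φₑ (suc n) = begin
      (1# + y) * φₒ n * ((1# + x * y) * φₑ n)
        ≈⟨ solve 4 (λ x y o e → (con true :+ y) :* o :* ((con true :+ x :* y) :* e)
             := (con true :+ x :* y) :* ((con true :+ y) :* (o :* e))) refl x y _ _ ⟩
      (1# + x * y) * ((1# + y) * (φₒ n * φₑ n))   ≈⟨ *-congˡ (*-congˡ (φₒ*φₑ n)) ⟩
      φ (2 ℕ.+ 2 ℕ.* n)                           ≡⟨ ≡.cong φ (ℕ.*-suc 2 n) ⟨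
      φ (2 ℕ.* suc n)                             ∎
      where y = x ^ (1 ℕ.+ 2 ℕ.* n)

    shanks-vanish : ∀ n m → x ^ (1 ℕ.+ 2 ℕ.* n) ≈ 0# → shanks n (suc m) ≈ 1#
    shanks-vanish n zero    y≈0 = trans (+-identityʳ _) (*-identityˡ 1#)
    shanks-vanish n (suc m) y≈0 = trans (+-cong
      (trans (*-congˡ (^-vanish y≈0 (ℕ.m≤m+n (1 ℕ.+ 2 ℕ.* n) _))) (zeroʳ _))
      (shanks-vanish n m y≈0)) (+-identityˡ 1#)

    -- Nilpotency gives φ(2n) = φ(n), hence φₒ φ^2 = φₒ φₑ = φ. Then φₒ φ^3 = φ^2 = φₑ, which is φₒ
    -- ψ by Shanks' identity with only the summand s = 0 left, and φₒ cancels. That summand exists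
    -- only for n > 0, whence `suc m`.
    φ³≈ψ : ∀ m → let n = suc m in x ^ suc n ≈ 0# → φ n ^ 3 ≈ ψ (2 ℕ.* n)
    φ³≈ψ m nilpotent = begin
      φ n ^ 3                                ≈⟨ *-identityˡ _ ⟨
      1# * φ n ^ 3                           ≈⟨ *-congʳ (φₒ-inverse n) ⟨
      φₒ n * φₒ⁻¹ n * φ n ^ 3                ≈⟨ solve 3 (λ o i f → o :* i :* (f :* (f :* (f :* con true)))
                                                  := i :* (f :* (o :* (f :* f)))) refl _ _ _ ⟩
      φₒ⁻¹ n * (φ n * (φₒ n * (φ n * φ n)))  ≈⟨ *-congˡ (*-congˡ (*-congˡ (φₑ≈φ² n))) ⟨
      φₒ⁻¹ n * (φ n * (φₒ n * φₑ n))         ≈⟨ *-congˡ (*-congˡ (trans (φₒ*φₑ n) φ-stable)) ⟩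
      φₒ⁻¹ n * (φ n * φ n)                   ≈⟨ *-congˡ (φₑ≈φ² n) ⟨
      φₒ⁻¹ n * φₑ n                          ≈⟨ *-congˡ (*-identityʳ _) ⟨
      φₒ⁻¹ n * (φₑ n * 1#)                   ≈⟨ *-congˡ (*-congˡ (shanks-vanish n m (^-vanish nilpotent
                                                  (ℕ.s≤s (ℕ.m≤m+n n _))))) ⟨
      φₒ⁻¹ n * (φₑ n * shanks n n)           ≈⟨ *-congˡ (shanks-identity n) ⟨
      φₒ⁻¹ n * (φₒ n * ψ (2 ℕ.* n))          ≈⟨ solve 3 (λ o i p → i :* (o :* p) := o :* i :* p) refl _ _ _ ⟩
      φₒ n * φₒ⁻¹ n * ψ (2 ℕ.* n)            ≈⟨ *-congʳ (φₒ-inverse n) ⟩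
      1# * ψ (2 ℕ.* n)                       ≈⟨ *-identityˡ _ ⟩
      ψ (2 ℕ.* n)                            ∎
      where
      n = suc m
      φ-stable : φ (2 ℕ.* n) ≈ φ n
      φ-stable = trans (reflexive (≡.cong φ (ℕ.+-comm n _)))
        (∏-truncate n (λ k n<k → trans (+-congˡ (^-vanish nilpotent n<k)) (+-identityʳ 1#)) (1 ℕ.* n))

  -- From Gauss' identity to the eta quotient.

  module EtaQuotient (q : Carrier) (g : ℕ → Carrier) (g-inverse : ∀ k → (1# + q ^ suc k) * g (suc k) ≈ 1#)
    (m : ℕ) (nilpotent : q ^ suc (suc m) ≈ 0#) where

    -- The beginning of ψ(q^d); `φ³≈ψ` yields two summands for each factor of the product, hence the
    -- length.
    theta : ℕ → Carrier
    theta d = ∑ (2 ℕ.* suc m) (λ l → q ^ (d ℕ.* tri l))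

    φ³≈theta : ∀ d → ∏ (suc m) (λ k → 1# + q ^ (suc d ℕ.* k)) ^ 3 ≈ theta (suc d)
    φ³≈theta d = begin
      ∏ (suc m) (λ k → 1# + q ^ (suc d ℕ.* k)) ^ 3
        ≈⟨ ^-congˡ 3 (∏-cong (λ k → +-congˡ (sym (^-assocʳ q (suc d) (suc k)))) (suc m)) ⟩
      φ (suc m) ^ 3        ≈⟨ φ³≈ψ m (trans (^-assocʳ q (suc d) (suc (suc m)))
                               (^-vanish nilpotent (ℕ.m≤n*m (suc (suc m)) (suc d)))) ⟩
      ψ (2 ℕ.* suc m)      ≈⟨ ∑-cong (λ l → ^-assocʳ q (suc d) (tri l)) (2 ℕ.* suc m) ⟩
      theta (suc d)        ∎
      where
      open Gauss (q ^ suc d) (λ k → g (suc d ℕ.* suc k))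
        (λ k → trans (*-congʳ (+-congˡ (^-assocʳ q (suc d) (suc k)))) (g-inverse _))

    -- Twelfth powers are cubes of fourth powers: Frobenius multiplies the exponents of q by 4, and
    -- the remaining cube is Gauss' identity.
    φ¹²≈theta : ∀ d → ∏ (suc m) (λ k → (1# + q ^ (suc d ℕ.* k)) ^ 12) ≈ theta (4 ℕ.* suc d)
    φ¹²≈theta d = begin
      ∏ (suc m) (λ k → (1# + q ^ (suc d ℕ.* k)) ^ 12)              ≈⟨ ∏-cong fourth (suc m) ⟩
      ∏ (suc m) (λ k → (1# + q ^ (4 ℕ.* suc d ℕ.* k)) ^ 3)         ≈⟨ ∏-^ _ 3 (suc m) ⟩
      -- `4 * suc d` reduces to `suc (d + 3 * suc d)`, which is why the argument is this
      -- predecessor.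
      ∏ (suc m) (λ k → 1# + q ^ (4 ℕ.* suc d ℕ.* k)) ^ 3           ≈⟨ φ³≈theta (d ℕ.+ 3 ℕ.* suc d) ⟩
      theta (4 ℕ.* suc d)                                          ∎
      where
      fourth : ∀ k → (1# + q ^ (suc d ℕ.* suc k)) ^ 12 ≈ (1# + q ^ (4 ℕ.* suc d ℕ.* suc k)) ^ 3
      fourth k = begin
        (1# + q ^ (suc d ℕ.* suc k)) ^ 12          ≈⟨ ^-assocʳ _ 4 3 ⟨
        ((1# + q ^ (suc d ℕ.* suc k)) ^ 4) ^ 3     ≈⟨ ^-congˡ 3 ([1+x]⁴ _) ⟩
        (1# + (q ^ (suc d ℕ.* suc k)) ^ 4) ^ 3     ≈⟨ ^-congˡ 3 (+-congˡ (^-assocʳ q (suc d ℕ.* suc k) 4)) ⟩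
        (1# + q ^ (suc d ℕ.* suc k ℕ.* 4)) ^ 3     ≡⟨ ≡.cong (λ e → (1# + q ^ e) ^ 3)
          (≡.trans (ℕ.*-comm (suc d ℕ.* suc k) 4) (≡.sym (ℕ.*-assoc 4 (suc d) (suc k)))) ⟩
        (1# + q ^ (4 ℕ.* suc d ℕ.* suc k)) ^ 3     ∎

    -- By `φ¹²≈theta 2`, `theta 12` is the product of the (1 + q^(3k))^12, which the inverses in F
    -- cancel; the numerator that remains is `theta 4` by `φ¹²≈theta 0`.
    quotient*theta₁₂ : ∀ {F} → (∀ k → F (suc k) ≈ (1# + q ^ suc k) ^ 12 * g (3 ℕ.* suc k) ^ 12) →
      ∏ (suc m) F * theta 12 ≈ theta 4
    quotient*theta₁₂ {F} factors = begin
      ∏ n F * theta 12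
        ≈⟨ *-congʳ (∏-cong factors n) ⟩
      ∏ n (λ k → (1# + q ^ k) ^ 12 * g (3 ℕ.* k) ^ 12) * theta 12
        ≈⟨ *-cong (∏-* _ _ n) (sym (φ¹²≈theta 2)) ⟩
      ∏ n (λ k → (1# + q ^ k) ^ 12) * ∏ n (λ k → g (3 ℕ.* k) ^ 12) * ∏ n (λ k → (1# + q ^ (3 ℕ.* k)) ^ 12)
        ≈⟨ *-assoc _ _ _ ⟩
      ∏ n (λ k → (1# + q ^ k) ^ 12) * (∏ n (λ k → g (3 ℕ.* k) ^ 12) * ∏ n (λ k → (1# + q ^ (3 ℕ.* k)) ^ 12))
        ≈⟨ *-congˡ (trans (sym (∏-* _ _ n)) (∏-1 inverse n)) ⟩
      ∏ n (λ k → (1# + q ^ k) ^ 12) * 1#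
        ≈⟨ *-identityʳ _ ⟩
      ∏ n (λ k → (1# + q ^ k) ^ 12)
        ≈⟨ ∏-cong (λ k → ^-congˡ 12 (+-congˡ (^-congʳ q (ℕ.*-identityˡ (suc k))))) n ⟨
      ∏ n (λ k → (1# + q ^ (1 ℕ.* k)) ^ 12)
        ≈⟨ φ¹²≈theta 0 ⟩
      theta 4 ∎
      where
      n = suc m
      inverse : ∀ k → g (3 ℕ.* suc k) ^ 12 * (1# + q ^ (3 ℕ.* suc k)) ^ 12 ≈ 1#
      inverse k = begin
        g (3 ℕ.* suc k) ^ 12 * (1# + q ^ (3 ℕ.* suc k)) ^ 12   ≈⟨ ^-distrib-* _ _ 12 ⟨
        (g (3 ℕ.* suc k) * (1# + q ^ (3 ℕ.* suc k))) ^ 12      ≈⟨ ^-congˡ 12 (trans (*-comm _ _) (g-inverse _)) ⟩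
        1# ^ 12                                                ≈⟨ 1^ 12 ⟩
        1#                                                     ∎

-- Power series modulo 2

module SeriesModuloTwo where
  open import Data.Integer using (_+_; _*_; _-_; -_)
  open import Data.Integer.DivMod using (_%ℕ_; _/ℕ_; n%ℕd<d; a≡a%ℕn+[a/ℕn]*n)
  open import Data.Integer.Divisibility.Signed
  open import Data.Integer.Properties
  open import Data.Integer.Tactic.RingSolver using (solve-∀)

  tail : Series → Series
  tail f m = f (suc m)

  zeroS : Series
  zeroS _ = 0ℤ

  infixl 6 _⊕_
  _⊕_ : Series → Series → Series
  (f ⊕ g) m = f m + g m

  ⊛-zero : ∀ f g → (f ⊛ g) 0 ≡ f 0 * g 0
  ⊛-zero f g = +-identityʳ _

  -- This recursion on `tail` replaces the list in the definition of the convolution, so that the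
  -- ring laws become inductions on the coefficient index.
  ⊛-suc : ∀ f g m → (f ⊛ g) (suc m) ≡ f 0 * g (suc m) + (tail f ⊛ g) m
  ⊛-suc f g m = cong (λ l → f 0 * g (suc m) + foldr _+_ 0ℤ l)
    (≡.trans (map-applyUpTo suc (λ i → f i * g (suc m ℕ.∸ i)) (suc m))
      (≡.sym (map-upTo (λ i → tail f i * g (m ℕ.∸ i)) (suc m))))

  module _ where
    open ≡.≡-Reasoning

    ⊛-congˡ : ∀ {f f′} g → (∀ m → f m ≡ f′ m) → ∀ m → (f ⊛ g) m ≡ (f′ ⊛ g) m
    ⊛-congˡ {f} {f′} g f≡f′ zero = begin
      (f ⊛ g) 0     ≡⟨ ⊛-zero f g ⟩
      f 0 * g 0     ≡⟨ cong (_* g 0) (f≡f′ 0) ⟩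
      f′ 0 * g 0    ≡⟨ ⊛-zero f′ g ⟨
      (f′ ⊛ g) 0    ∎
    ⊛-congˡ {f} {f′} g f≡f′ (suc m) = begin
      (f ⊛ g) (suc m)                      ≡⟨ ⊛-suc f g m ⟩
      f 0 * g (suc m) + (tail f ⊛ g) m     ≡⟨ cong₂ (λ a b → a * g (suc m) + b) (f≡f′ 0) (⊛-congˡ g (f≡f′ ∘ suc) m) ⟩
      f′ 0 * g (suc m) + (tail f′ ⊛ g) m   ≡⟨ ⊛-suc f′ g m ⟨
      (f′ ⊛ g) (suc m)                     ∎

    ⊛-zeroˡ : ∀ g m → (zeroS ⊛ g) m ≡ 0ℤ
    ⊛-zeroˡ g zero    = ⊛-zero zeroS g
    ⊛-zeroˡ g (suc m) = ≡.trans (⊛-suc zeroS g m) (≡.trans (+-identityˡ _) (⊛-zeroˡ g m))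

    ⊛-identityˡ : ∀ g m → (oneS ⊛ g) m ≡ g m
    ⊛-identityˡ g zero    = ≡.trans (⊛-zero oneS g) (*-identityˡ (g 0))
    ⊛-identityˡ g (suc m) = begin
      (oneS ⊛ g) (suc m)               ≡⟨ ⊛-suc oneS g m ⟩
      1ℤ * g (suc m) + (zeroS ⊛ g) m   ≡⟨ cong₂ _+_ (*-identityˡ (g (suc m))) (⊛-zeroˡ g m) ⟩
      g (suc m) + 0ℤ                   ≡⟨ +-identityʳ _ ⟩
      g (suc m)                        ∎

    ⊛-distribʳ : ∀ h f g m → ((f ⊕ g) ⊛ h) m ≡ (f ⊛ h) m + (g ⊛ h) m
    ⊛-distribʳ h f g zero = begin
      ((f ⊕ g) ⊛ h) 0            ≡⟨ ⊛-zero (f ⊕ g) h ⟩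
      (f 0 + g 0) * h 0          ≡⟨ *-distribʳ-+ (h 0) (f 0) (g 0) ⟩
      f 0 * h 0 + g 0 * h 0      ≡⟨ cong₂ _+_ (⊛-zero f h) (⊛-zero g h) ⟨
      (f ⊛ h) 0 + (g ⊛ h) 0      ∎
    ⊛-distribʳ h f g (suc m) = begin
      ((f ⊕ g) ⊛ h) (suc m)                                              ≡⟨ ⊛-suc (f ⊕ g) h m ⟩
      (f 0 + g 0) * h (suc m) + ((tail f ⊕ tail g) ⊛ h) m
        ≡⟨ cong (_+_ ((f 0 + g 0) * h (suc m))) (⊛-distribʳ h (tail f) (tail g) m) ⟩
      (f 0 + g 0) * h (suc m) + ((tail f ⊛ h) m + (tail g ⊛ h) m)        ≡⟨ regroup (f 0) (g 0) (h (suc m)) _ _ ⟩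
      f 0 * h (suc m) + (tail f ⊛ h) m + (g 0 * h (suc m) + (tail g ⊛ h) m)
        ≡⟨ cong₂ _+_ (⊛-suc f h m) (⊛-suc g h m) ⟨
      (f ⊛ h) (suc m) + (g ⊛ h) (suc m)                                  ∎
      where
      regroup : ∀ a b c x y → (a + b) * c + (x + y) ≡ a * c + x + (b * c + y)
      regroup = solve-∀

    ⊛-scaleˡ : ∀ c f g m → ((λ i → c * f i) ⊛ g) m ≡ c * (f ⊛ g) m
    ⊛-scaleˡ c f g zero = begin
      ((λ i → c * f i) ⊛ g) 0   ≡⟨ ⊛-zero (λ i → c * f i) g ⟩
      c * f 0 * g 0             ≡⟨ *-assoc c (f 0) (g 0) ⟩
      c * (f 0 * g 0)           ≡⟨ cong (c *_) (⊛-zero f g) ⟨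
      c * (f ⊛ g) 0             ∎
    ⊛-scaleˡ c f g (suc m) = begin
      ((λ i → c * f i) ⊛ g) (suc m)                                  ≡⟨ ⊛-suc (λ i → c * f i) g m ⟩
      c * f 0 * g (suc m) + ((λ i → c * tail f i) ⊛ g) m             ≡⟨ cong (_+_ (c * f 0 * g (suc m))) (⊛-scaleˡ c (tail f) g m) ⟩
      c * f 0 * g (suc m) + c * (tail f ⊛ g) m                       ≡⟨ factor c (f 0) (g (suc m)) _ ⟩
      c * (f 0 * g (suc m) + (tail f ⊛ g) m)                         ≡⟨ cong (c *_) (⊛-suc f g m) ⟨
      c * (f ⊛ g) (suc m)                                            ∎
      where
      factor : ∀ c a b x → c * a * b + c * x ≡ c * (a * b + x)
      factor = solve-∀

    ⊛-assoc : ∀ f g h m → ((f ⊛ g) ⊛ h) m ≡ (f ⊛ (g ⊛ h)) m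
    ⊛-assoc f g h zero = begin
      ((f ⊛ g) ⊛ h) 0        ≡⟨ ⊛-zero (f ⊛ g) h ⟩
      (f ⊛ g) 0 * h 0        ≡⟨ cong (_* h 0) (⊛-zero f g) ⟩
      f 0 * g 0 * h 0        ≡⟨ *-assoc (f 0) (g 0) (h 0) ⟩
      f 0 * (g 0 * h 0)      ≡⟨ cong (f 0 *_) (⊛-zero g h) ⟨
      f 0 * (g ⊛ h) 0        ≡⟨ ⊛-zero f (g ⊛ h) ⟨
      (f ⊛ (g ⊛ h)) 0        ∎
    ⊛-assoc f g h (suc m) = begin
      ((f ⊛ g) ⊛ h) (suc m)                                              ≡⟨ ⊛-suc (f ⊛ g) h m ⟩
      (f ⊛ g) 0 * h (suc m) + (tail (f ⊛ g) ⊛ h) m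
        ≡⟨ cong₂ (λ a b → a * h (suc m) + b) (⊛-zero f g) (⊛-congˡ h (⊛-suc f g) m) ⟩
      f 0 * g 0 * h (suc m) + (((λ i → f 0 * tail g i) ⊕ (tail f ⊛ g)) ⊛ h) m
        ≡⟨ cong (_+_ (f 0 * g 0 * h (suc m))) (⊛-distribʳ h (λ i → f 0 * tail g i) (tail f ⊛ g) m) ⟩
      f 0 * g 0 * h (suc m) + (((λ i → f 0 * tail g i) ⊛ h) m + ((tail f ⊛ g) ⊛ h) m)
        ≡⟨ cong (_+_ (f 0 * g 0 * h (suc m))) (cong₂ _+_ (⊛-scaleˡ (f 0) (tail g) h m) (⊛-assoc (tail f) g h m)) ⟩
      f 0 * g 0 * h (suc m) + (f 0 * (tail g ⊛ h) m + (tail f ⊛ (g ⊛ h)) m)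
        ≡⟨ regroup (f 0) (g 0) (h (suc m)) _ _ ⟩
      f 0 * (g 0 * h (suc m) + (tail g ⊛ h) m) + (tail f ⊛ (g ⊛ h)) m
        ≡⟨ cong (λ a → f 0 * a + (tail f ⊛ (g ⊛ h)) m) (⊛-suc g h m) ⟨
      f 0 * (g ⊛ h) (suc m) + (tail f ⊛ (g ⊛ h)) m                       ≡⟨ ⊛-suc f (g ⊛ h) m ⟨
      (f ⊛ (g ⊛ h)) (suc m)                                              ∎
      where
      regroup : ∀ a b c x y → a * b * c + (a * x + y) ≡ a * (b * c + x) + y
      regroup = solve-∀

    -- The mirror image of `⊛-suc`, splitting off the last product instead of the first; the two
    -- together give commutativity.
    ⊛-sucʳ : ∀ f g m → (f ⊛ g) (suc m) ≡ f (suc m) * g 0 + (f ⊛ tail g) m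
    ⊛-sucʳ f g zero = begin
      (f ⊛ g) 1                         ≡⟨ ⊛-suc f g 0 ⟩
      f 0 * g 1 + (tail f ⊛ g) 0        ≡⟨ cong (_+_ (f 0 * g 1)) (⊛-zero (tail f) g) ⟩
      f 0 * g 1 + f 1 * g 0             ≡⟨ +-comm (f 0 * g 1) _ ⟩
      f 1 * g 0 + f 0 * g 1             ≡⟨ cong (_+_ (f 1 * g 0)) (⊛-zero f (tail g)) ⟨
      f 1 * g 0 + (f ⊛ tail g) 0        ∎
    ⊛-sucʳ f g (suc m) = begin
      (f ⊛ g) (2 ℕ.+ m)                                                       ≡⟨ ⊛-suc f g (suc m) ⟩
      f 0 * g (2 ℕ.+ m) + (tail f ⊛ g) (suc m)
        ≡⟨ cong (_+_ (f 0 * g (2 ℕ.+ m))) (⊛-sucʳ (tail f) g m) ⟩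
      f 0 * g (2 ℕ.+ m) + (f (2 ℕ.+ m) * g 0 + (tail f ⊛ tail g) m)          ≡⟨ swap (f 0 * g (2 ℕ.+ m)) (f (2 ℕ.+ m) * g 0) _ ⟩
      f (2 ℕ.+ m) * g 0 + (f 0 * g (2 ℕ.+ m) + (tail f ⊛ tail g) m)
        ≡⟨ cong (_+_ (f (2 ℕ.+ m) * g 0)) (⊛-suc f (tail g) m) ⟨
      f (2 ℕ.+ m) * g 0 + (f ⊛ tail g) (suc m)                               ∎
      where
      swap : ∀ a b c → a + (b + c) ≡ b + (a + c)
      swap = solve-∀

    ⊛-comm : ∀ f g m → (f ⊛ g) m ≡ (g ⊛ f) m
    ⊛-comm f g zero = ≡.trans (⊛-zero f g) (≡.trans (*-comm (f 0) (g 0)) (≡.sym (⊛-zero g f)))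
    ⊛-comm f g (suc m) = begin
      (f ⊛ g) (suc m)                      ≡⟨ ⊛-suc f g m ⟩
      f 0 * g (suc m) + (tail f ⊛ g) m     ≡⟨ cong₂ _+_ (*-comm (f 0) _) (⊛-comm (tail f) g m) ⟩
      g (suc m) * f 0 + (g ⊛ tail f) m     ≡⟨ ⊛-sucʳ g f m ⟨
      (g ⊛ f) (suc m)                      ∎

  -- Congruence modulo 2 and the truncated semiring.

  infix 4 _≡₂_
  -- As a record it is injective in its arguments, so a and b can be inferred, which a divisibility
  -- statement about the computed difference would not allow.
  record _≡₂_ (a b : ℤ) : Set where
    constructor mod2
    field 2∣a-b : + 2 ∣ a - b

  2∣-subst : ∀ {a b} → a ≡ b → + 2 ∣ a → + 2 ∣ b
  2∣-subst = ≡.subst (+ 2 ∣_)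

  ≡₂-reflexive : ∀ {a b} → a ≡ b → a ≡₂ b
  ≡₂-reflexive {a} ≡.refl = mod2 (divides 0ℤ (+-inverseʳ a))

  ≡₂-refl : ∀ {a} → a ≡₂ a
  ≡₂-refl = ≡₂-reflexive ≡.refl

  ≡₂-sym : ∀ {a b} → a ≡₂ b → b ≡₂ a
  ≡₂-sym {a} {b} (mod2 p) = mod2 (2∣-subst (swap a b) (∣m⇒∣-m p))
    where
    swap : ∀ a b → - (a - b) ≡ b - a
    swap = solve-∀

  ≡₂-trans : ∀ {a b c} → a ≡₂ b → b ≡₂ c → a ≡₂ c
  ≡₂-trans {a} {b} {c} (mod2 p) (mod2 q) = mod2 (2∣-subst (telescope a b c) (∣m∣n⇒∣m+n p q))
    where
    telescope : ∀ a b c → a - b + (b - c) ≡ a - c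
    telescope = solve-∀

  +-cong₂ : ∀ {a b c d} → a ≡₂ b → c ≡₂ d → a + c ≡₂ b + d
  +-cong₂ {a} {b} {c} {d} (mod2 p) (mod2 q) = mod2 (2∣-subst (regroup a b c d) (∣m∣n⇒∣m+n p q))
    where
    regroup : ∀ a b c d → a - b + (c - d) ≡ a + c - (b + d)
    regroup = solve-∀

  *-cong₂ : ∀ {a b c d} → a ≡₂ b → c ≡₂ d → a * c ≡₂ b * d
  *-cong₂ {a} {b} {c} {d} (mod2 p) (mod2 q) =
    mod2 (2∣-subst (regroup a b c d) (∣m∣n⇒∣m+n (∣m⇒∣m*n c p) (∣n⇒∣m*n b q)))
    where
    regroup : ∀ a b c d → (a - b) * c + b * (c - d) ≡ a * c - b * d
    regroup = solve-∀

  a+a≡₂0 : ∀ a → a + a ≡₂ 0ℤ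
  a+a≡₂0 a = mod2 (divides a (double a))
    where
    double : ∀ a → a + a - 0ℤ ≡ a * + 2
    double = solve-∀

  1+[1+a]≡₂a : ∀ a → 1ℤ + (1ℤ + a) ≡₂ a
  1+[1+a]≡₂a a = mod2 (divides 1ℤ (cancel a))
    where
    cancel : ∀ a → 1ℤ + (1ℤ + a) - a ≡ 1ℤ * + 2
    cancel = solve-∀

  parity : ∀ a → a ≡₂ 0ℤ ⊎ a ≡₂ 1ℤ
  parity a = residue (a %ℕ 2) (n%ℕd<d a 2) (a≡a%ℕn+[a/ℕn]*n a 2)
    where
    cancel : ∀ r b → r + b - r ≡ b
    cancel = solve-∀

    residue : ∀ r → r < 2 → a ≡ + r + a /ℕ 2 * + 2 → a ≡₂ 0ℤ ⊎ a ≡₂ 1ℤ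
    residue 0 _ e = inj₁ (mod2 (divides (a /ℕ 2) (≡.trans (cong (_- 0ℤ) e) (cancel 0ℤ (a /ℕ 2 * + 2)))))
    residue 1 _ e = inj₂ (mod2 (divides (a /ℕ 2) (≡.trans (cong (_- 1ℤ) e) (cancel 1ℤ (a /ℕ 2 * + 2)))))
    residue (suc (suc _)) (s≤s (s≤s ())) _

  0≢₂1 : ¬ 0ℤ ≡₂ 1ℤ
  0≢₂1 (mod2 p) with ∣⇒∣ᵤ p
  ... | ℕ.divides zero ()
  ... | ℕ.divides (suc _) ()

  ≡₂-setoid : Setoid 0ℓ 0ℓ
  ≡₂-setoid = record
    { Carrier = ℤ ; _≈_ = _≡₂_ ; isEquivalence = record { refl = ≡₂-refl ; sym = ≡₂-sym ; trans = ≡₂-trans } }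

  a²≡₂a : ∀ a → a * a ≡₂ a
  a²≡₂a a with parity a
  ... | inj₁ e = ≡₂-trans (*-cong₂ e e) (≡₂-sym e)
  ... | inj₂ e = ≡₂-trans (*-cong₂ e e) (≡₂-sym e)

  -- Congruence modulo (2 , q^(N+1)).
  infix 4 _≈[_]_
  record _≈[_]_ (f : Series) (N : ℕ) (g : Series) : Set where
    constructor agree
    field coefficient : ∀ m → m ≤ N → f m ≡₂ g m
  open _≈[_]_

  pointwise : ∀ {f g N} → (∀ m → f m ≡ g m) → f ≈[ N ] g
  pointwise f≡g = agree (λ m _ → ≡₂-reflexive (f≡g m))

  -- A coefficient of a product involves no higher coefficients of the factors. Hence truncation is
  -- compatible with multiplication.
  ⊛-cong₂ : ∀ {f f′ g g′} m → f ≈[ m ] f′ → g ≈[ m ] g′ → (f ⊛ g) m ≡₂ (f′ ⊛ g′) m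
  ⊛-cong₂ {f} {f′} {g} {g′} zero (agree p) (agree q) = begin
    (f ⊛ g) 0       ≡⟨ ⊛-zero f g ⟩
    f 0 * g 0       ≈⟨ *-cong₂ (p 0 z≤n) (q 0 z≤n) ⟩
    f′ 0 * g′ 0     ≡⟨ ⊛-zero f′ g′ ⟨
    (f′ ⊛ g′) 0     ∎
    where open Relation.Binary.Reasoning.Setoid ≡₂-setoid
  ⊛-cong₂ {f} {f′} {g} {g′} (suc m) (agree p) (agree q) = begin
    (f ⊛ g) (suc m)                         ≡⟨ ⊛-suc f g m ⟩
    f 0 * g (suc m) + (tail f ⊛ g) m
      ≈⟨ +-cong₂ (*-cong₂ (p 0 z≤n) (q (suc m) ℕ.≤-refl))
           (⊛-cong₂ m (agree (λ i i≤m → p (suc i) (s≤s i≤m))) (agree (λ i i≤m → q i (ℕ.m≤n⇒m≤1+n i≤m)))) ⟩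
    f′ 0 * g′ (suc m) + (tail f′ ⊛ g′) m    ≡⟨ ⊛-suc f′ g′ m ⟨
    (f′ ⊛ g′) (suc m)                       ∎
    where open Relation.Binary.Reasoning.Setoid ≡₂-setoid

  ≈-restrict : ∀ {f g m N} → m ≤ N → f ≈[ N ] g → f ≈[ m ] g
  ≈-restrict m≤N (agree p) = agree (λ i i≤m → p i (ℕ.≤-trans i≤m m≤N))

  -- Were ⊛ itself the multiplication of the semiring below, comparing twelfth
  -- powers would unfold them into nested convolutions.
  infixl 7 _⋆_
  opaque
    _⋆_ : Series → Series → Series
    _⋆_ = _⊛_

    ⋆≡⊛ : ∀ f g → f ⋆ g ≡ f ⊛ g
    ⋆≡⊛ f g = ≡.refl

    ⋆-isCommutativeSemiring : ∀ N → IsCommutativeSemiring (_≈[ N ]_) _⊕_ _⋆_ zeroS oneS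
    ⋆-isCommutativeSemiring N = IsCommutativeSemiringˡ.isCommutativeSemiring record
      { +-isCommutativeMonoid = IsCommutativeMonoidˡ.isCommutativeMonoid record
        { isSemigroup = record
          { isMagma = record
            { isEquivalence = ≈-isEquivalence
            ; ∙-cong = λ (agree p) (agree q) → agree (λ m m≤N → +-cong₂ (p m m≤N) (q m m≤N)) }
          ; assoc = λ f g h → pointwise (λ m → +-assoc (f m) (g m) (h m)) }
        ; identityˡ = λ f → pointwise (λ m → +-identityˡ (f m))
        ; comm = λ f g → pointwise (λ m → +-comm (f m) (g m)) }
      ; *-isCommutativeMonoid = IsCommutativeMonoidˡ.isCommutativeMonoid record
        { isSemigroup = record
          { isMagma = record
            { isEquivalence = ≈-isEquivalence
            ; ∙-cong = λ p q → agree (λ m m≤N → ⊛-cong₂ m (≈-restrict m≤N p) (≈-restrict m≤N q)) }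
          ; assoc = λ f g h → pointwise (⊛-assoc f g h) }
        ; identityˡ = λ f → pointwise (⊛-identityˡ f)
        ; comm = λ f g → pointwise (⊛-comm f g) }
      ; distribʳ = λ h f g → pointwise (⊛-distribʳ h f g)
      ; zeroˡ = λ f → pointwise (⊛-zeroˡ f)
      }
      where
      open Algebra.Structures.Biased (_≈[ N ]_) using (IsCommutativeSemiringˡ; IsCommutativeMonoidˡ)
      ≈-isEquivalence : IsEquivalence (_≈[ N ]_)
      ≈-isEquivalence = record
        { refl = agree (λ _ _ → ≡₂-refl)
        ; sym = λ (agree p) → agree (λ m m≤N → ≡₂-sym (p m m≤N))
        ; trans = λ (agree p) (agree q) → agree (λ m m≤N → ≡₂-trans (p m m≤N) (q m m≤N))
        }

  truncatedSeries : ℕ → CommutativeSemiring 0ℓ 0ℓ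
  truncatedSeries N = record { isCommutativeSemiring = ⋆-isCommutativeSemiring N }

  1+1≈0 : ∀ {N} → oneS ⊕ oneS ≈[ N ] zeroS
  1+1≈0 = agree (λ m _ → a+a≡₂0 (oneS m))

  -- Powers of q and geometric series.

  q : Series
  q zero    = 0ℤ
  q (suc m) = oneS m

  q⊛-zero : ∀ f → (q ⊛ f) 0 ≡ 0ℤ
  q⊛-zero f = ⊛-zero q f

  q⊛-suc : ∀ f m → (q ⊛ f) (suc m) ≡ f m
  q⊛-suc f m = ≡.trans (⊛-suc q f m) (≡.trans (+-identityˡ _) (⊛-identityˡ f m))

  q^-coefficient : ∀ k m → (q ^S k) m ≡ (if does (k ℕ.≟ m) then 1ℤ else 0ℤ)
  q^-coefficient zero    zero    = ≡.refl
  q^-coefficient zero    (suc m) = ≡.refl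
  q^-coefficient (suc k) zero    = q⊛-zero (q ^S k)
  q^-coefficient (suc k) (suc m) = ≡.trans (q⊛-suc (q ^S k) m) (q^-coefficient k m)

  q^suc⊛-zero : ∀ k f → ((q ^S suc k) ⊛ f) 0 ≡ 0ℤ
  q^suc⊛-zero k f = ≡.trans (⊛-assoc q (q ^S k) f 0) (q⊛-zero ((q ^S k) ⊛ f))

  q^suc⊛-suc : ∀ k f m → ((q ^S suc k) ⊛ f) (suc m) ≡ ((q ^S k) ⊛ f) m
  q^suc⊛-suc k f m = ≡.trans (⊛-assoc q (q ^S k) f (suc m)) (q⊛-suc ((q ^S k) ⊛ f) m)

  q^⊛-shift : ∀ k f m → ((q ^S k) ⊛ f) (k ℕ.+ m) ≡ f m
  q^⊛-shift zero    f m = ⊛-identityˡ f m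
  q^⊛-shift (suc k) f m = ≡.trans (q^suc⊛-suc k f (k ℕ.+ m)) (q^⊛-shift k f m)

  q^⊛-low : ∀ {k m} f → m < k → ((q ^S k) ⊛ f) m ≡ 0ℤ
  q^⊛-low {suc k} {zero}  f _         = q^suc⊛-zero k f
  q^⊛-low {suc k} {suc m} f (s≤s m<k) = ≡.trans (q^suc⊛-suc k f m) (q^⊛-low f m<k)

  q^-≢ : ∀ {k m} → k ≢ m → (q ^S k) m ≡ 0ℤ
  q^-≢ {k} {m} k≢m = ≡.trans (q^-coefficient k m) (cong (if_then 1ℤ else 0ℤ) (dec-false (k ℕ.≟ m) k≢m))

  q^-vanish : ∀ {k N} → N < k → q ^S k ≈[ N ] zeroS
  q^-vanish N<k = agree (λ m m≤N → ≡₂-reflexive (q^-≢ (ℕ.>⇒≢ (ℕ.≤-<-trans m≤N N<k))))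

  oneMinusQ≈1+q^ : ∀ k {N} → oneMinusQ (suc k) ≈[ N ] oneS ⊕ (q ^S suc k)
  oneMinusQ≈1+q^ k {N} = agree coefficients
    where
    negate : ∀ b → (if b then -1ℤ else 0ℤ) ≡₂ (if b then 1ℤ else 0ℤ)
    negate true  = mod2 (divides -1ℤ ≡.refl)
    negate false = ≡₂-refl

    coefficients : ∀ m → m ≤ N → oneMinusQ (suc k) m ≡₂ (oneS ⊕ (q ^S suc k)) m
    coefficients zero    _ = ≡₂-reflexive (≡.sym (cong (_+_ 1ℤ) (q⊛-zero (q ^S k))))
    coefficients (suc m) _ = ≡₂-trans (negate (does (suc k ℕ.≟ suc m)))
      (≡₂-reflexive (≡.sym (≡.trans (+-identityˡ _) (q^-coefficient (suc k) (suc m)))))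

  geom-periodic : ∀ k m → geom k (k ℕ.+ m) ≡ geom k m
  geom-periodic k m with k ℕ.∣? (k ℕ.+ m) | k ℕ.∣? m
  ... | yes _ | yes _ = ≡.refl
  ... | no  _ | no  _ = ≡.refl
  ... | yes p | no ¬p = contradiction (ℕ.∣m+n∣m⇒∣n p ℕ.∣-refl) ¬p
  ... | no ¬p | yes p = contradiction (ℕ.∣m∣n⇒∣m+n ℕ.∣-refl p) ¬p

  geom-low : ∀ {k m} → m < k → geom k m ≡ oneS m
  geom-low {k} {zero}  _   with k ℕ.∣? 0
  ... | yes _ = ≡.refl
  ... | no ¬p = contradiction (k ℕ.∣0) ¬p
  geom-low {k} {suc m} m<k with k ℕ.∣? suc m
  ... | yes p = contradiction p (ℕ.>⇒∤ m<k)
  ... | no  _ = ≡.refl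

  -- Below q^(k+1) the shifted copy of the geometric series is zero, leaving the coefficients of 1.
  -- From q^(k+1) on, periodicity makes the two copies equal, and they cancel modulo 2.
  geom-inverse : ∀ k {N} → (oneS ⊕ (q ^S suc k)) ⊛ geom (suc k) ≈[ N ] oneS
  geom-inverse k = agree λ m _ → ≡₂-trans (≡₂-reflexive (expand m)) (cancel m)
    where
    expand : ∀ m → ((oneS ⊕ (q ^S suc k)) ⊛ geom (suc k)) m ≡ geom (suc k) m + ((q ^S suc k) ⊛ geom (suc k)) m
    expand m = ≡.trans (⊛-distribʳ (geom (suc k)) oneS (q ^S suc k) m)
      (cong (_+ ((q ^S suc k) ⊛ geom (suc k)) m) (⊛-identityˡ (geom (suc k)) m))

    cancel : ∀ m → geom (suc k) m + ((q ^S suc k) ⊛ geom (suc k)) m ≡₂ oneS m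
    cancel m with m ℕ.<? suc k
    ... | yes m<k = ≡₂-reflexive (≡.trans (cong₂ _+_ (geom-low m<k) (q^⊛-low (geom (suc k)) m<k)) (+-identityʳ _))
    ... | no  m≮k with ℕ.m≤n⇒∃[o]m+o≡n (ℕ.≮⇒≥ m≮k)
    ... | o , ≡.refl = ≡₂-trans
      (≡₂-reflexive (cong₂ _+_ (geom-periodic (suc k) o) (q^⊛-shift (suc k) (geom (suc k)) o)))
      (a+a≡₂0 (geom (suc k) o))

-- The eta quotients

open import Data.Nat using (_+_; _*_; _∸_; _%_)
open import Data.Integer.Divisibility using (_∣_)

open SeriesModuloTwo
open FiniteSums ℤ.+-*-commutativeSemiring using () renaming (∑ to ∑ℤ)

module Truncated (N : ℕ) where
  open CommutativeSemiring (truncatedSeries N) public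
    using (_≈_; refl; sym; trans; reflexive; *-cong; *-congˡ; *-congʳ; *-comm; *-identityʳ; setoid; semiring)
  open FiniteSums (truncatedSeries N) public
  open Algebra.Properties.Semiring.Exp semiring public
  open Algebra.Properties.CommutativeSemiring.Exp (truncatedSeries N) public using (^-distrib-*)

  prodTo≡∏ : ∀ n F → prodTo n F ≡ ∏ n F
  prodTo≡∏ zero    F = ≡.refl
  prodTo≡∏ (suc n) F = ≡.trans (cong (F (suc n) ⊛_) (prodTo≡∏ n F)) (≡.sym (⋆≡⊛ (F (suc n)) (∏ n F)))

  ^S≡^ : ∀ f n → f ^S n ≡ f ^ n
  ^S≡^ f zero    = ≡.refl
  ^S≡^ f (suc n) = ≡.trans (cong (f ⊛_) (^S≡^ f n)) (≡.sym (⋆≡⊛ f (f ^ n)))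

  ^S⊛^S≡^⋆^ : ∀ f g m n → (f ^S m) ⊛ (g ^S n) ≡ f ^ m ⋆ g ^ n
  ^S⊛^S≡^⋆^ f g m n = ≡.trans (cong₂ _⊛_ (^S≡^ f m) (^S≡^ g n)) (≡.sym (⋆≡⊛ (f ^ m) (g ^ n)))

  factorA≡ : ∀ k → factorA k ≡ oneMinusQ k ^ 12 ⋆ geom (3 * k) ^ 12
  factorA≡ k = ^S⊛^S≡^⋆^ (oneMinusQ k) (geom (3 * k)) 12 12

  factorB≡ : ∀ k → factorB k ≡ oneMinusQ (3 * k) ^ 12 ⋆ geom k ^ 12
  factorB≡ k = ^S⊛^S≡^⋆^ (oneMinusQ (3 * k)) (geom k) 12 12

  ∑-coefficient : ∀ n F m → ∑ n F m ≡ ∑ℤ n (λ l → F l m)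
  ∑-coefficient zero    F m = ≡.refl
  ∑-coefficient (suc n) F m = cong (ℤ._+_ (F n m)) (∑-coefficient n F m)

  ∑-extract : ∀ a b F G → ∑ a F ≈ ∑ b G → ∑ℤ a (λ l → F l N) ≡₂ ∑ℤ b (λ l → G l N)
  ∑-extract a b F G F≈G = ≡₂-trans (≡₂-reflexive (≡.sym (∑-coefficient a F N)))
    (≡₂-trans (_≈[_]_.coefficient F≈G N ℕ.≤-refl) (≡₂-reflexive (∑-coefficient b G N)))

oneMinusQ-low : ∀ {k N} → N < k → oneMinusQ k ≈[ N ] oneS
oneMinusQ-low {k} N<k = agree λ where
  zero    _   → ≡₂-refl
  (suc m) m<N → ≡₂-reflexive (cong (if_then -1ℤ else 0ℤ)
    (dec-false (k ℕ.≟ suc m) (ℕ.>⇒≢ (ℕ.≤-<-trans m<N N<k))))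

-- `infProdCoeff` uses a different finite product for each coefficient, while the theta relation
-- concerns a single one. The factors beyond m are 1 up to q^m, so a longer product has the same
-- coefficient modulo 2.
prodTo-stable : ∀ m d → prodTo (d + m) factorA m ≡₂ infProdCoeff factorA m
prodTo-stable m d = _≈[_]_.coefficient stable m ℕ.≤-refl
  where
  open Truncated m
  open Relation.Binary.Reasoning.Setoid setoid
  geom-low₂ : ∀ {k} → m < k → geom (3 * k) ≈ oneS
  geom-low₂ {k} m<k = agree (λ i i≤m →
    ≡₂-reflexive (geom-low (ℕ.≤-<-trans i≤m (ℕ.<-≤-trans m<k (ℕ.m≤n*m k 3)))))
  factorA≈1 : ∀ k → m < k → factorA k ≈ oneS
  factorA≈1 k m<k = begin
    factorA k                                ≡⟨ factorA≡ k ⟩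
    oneMinusQ k ^ 12 ⋆ geom (3 * k) ^ 12     ≈⟨ *-cong (^-congˡ 12 (oneMinusQ-low m<k)) (^-congˡ 12 (geom-low₂ m<k)) ⟩
    oneS ^ 12 ⋆ oneS ^ 12                    ≈⟨ *-cong (1^ 12) (1^ 12) ⟩
    oneS ⋆ oneS                              ≈⟨ *-identityʳ oneS ⟩
    oneS                                     ∎
  stable : prodTo (d + m) factorA ≈ prodTo m factorA
  stable = begin
    prodTo (d + m) factorA     ≡⟨ prodTo≡∏ (d + m) factorA ⟩
    ∏ (d + m) factorA          ≈⟨ ∏-truncate m factorA≈1 d ⟩
    ∏ m factorA                ≡⟨ prodTo≡∏ m factorA ⟨
    prodTo m factorA           ∎

prodTo-stable-≤ : ∀ {m n} → m ≤ n → prodTo n factorA m ≡₂ infProdCoeff factorA m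
prodTo-stable-≤ {m} {n} m≤n =
  ≡.subst (λ k → prodTo k factorA m ≡₂ infProdCoeff factorA m) (ℕ.m∸n+n≡m m≤n) (prodTo-stable m (n ∸ m))

module Theta (N : ℕ) where
  open Truncated N

  -- The exponent N+2 goes with products of N+1 factors, a number that is positive even for N = 0.
  q^-nilpotent : q ^ suc (suc N) ≈ zeroS
  q^-nilpotent = trans (reflexive (≡.sym (^S≡^ q (suc (suc N))))) (q^-vanish (ℕ.m≤n⇒m≤1+n ℕ.≤-refl))

  inverse : ∀ k → (oneS ⊕ q ^ suc k) ⋆ geom (suc k) ≈ oneS
  inverse k = trans (reflexive (≡.trans (⋆≡⊛ (oneS ⊕ q ^ suc k) (geom (suc k)))
    (cong (λ p → (oneS ⊕ p) ⊛ geom (suc k)) (≡.sym (^S≡^ q (suc k)))))) (geom-inverse k)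

  open CharacteristicTwo (truncatedSeries N) 1+1≈0
  open EtaQuotient q geom inverse N q^-nilpotent public

  factorA≈ : ∀ k → factorA (suc k) ≈ (oneS ⊕ q ^ suc k) ^ 12 ⋆ geom (3 * suc k) ^ 12
  factorA≈ k = trans (reflexive (factorA≡ (suc k))) (*-congʳ (^-congˡ 12
    (trans (oneMinusQ≈1+q^ k) (reflexive (cong (oneS ⊕_) (^S≡^ q (suc k)))))))

  prodTo*theta₁₂ : prodTo (suc N) factorA ⋆ theta 12 ≈ theta 4
  prodTo*theta₁₂ = ≡.subst (λ p → p ⋆ theta 12 ≈ theta 4) (≡.sym (prodTo≡∏ (suc N) factorA))
    (quotient*theta₁₂ {factorA} factorA≈)

-- Comparison of the coefficients of q^(12 T_t).

q^⊛-coefficient : ∀ {k m} f → k ≤ m → ((q ^S k) ⊛ f) m ≡ f (m ∸ k)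
q^⊛-coefficient {k} {m} f k≤m =
  ≡.subst (λ n → ((q ^S k) ⊛ f) n ≡ f (m ∸ k)) (ℕ.m+[n∸m]≡n k≤m) (q^⊛-shift k f (m ∸ k))

tri-mono-≤ : ∀ {l t} → l ≤ t → tri l ≤ tri t
tri-mono-≤ z≤n       = z≤n
tri-mono-≤ (s≤s l≤t) = ℕ.+-mono-≤ (s≤s l≤t) (tri-mono-≤ l≤t)

-- The smallest gap, T_t - T_(t-1) = t, is the source of the lower end 12t - 1 of the interval.
t≤tri[t]∸tri[l] : ∀ {l t} → l < t → t ≤ tri t ∸ tri l
t≤tri[t]∸tri[l] {l} {suc t} (s≤s l≤t) = begin
  suc t                         ≤⟨ ℕ.m≤m+n (suc t) (tri t ∸ tri l) ⟩
  suc t + (tri t ∸ tri l)       ≡⟨ ℕ.+-∸-assoc (suc t) (tri-mono-≤ l≤t) ⟨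
  suc t + tri t ∸ tri l         ∎
  where open ℕ.≤-Reasoning

12*tri : ∀ t → 12 * tri t ≡ 6 * t * (t + 1)
12*tri t = ≡.trans (ℕ.*-assoc 6 2 (tri t)) (≡.trans (cong (6 *_) (2*tri t)) (≡.sym (ℕ.*-assoc 6 t (t + 1))))

-- The contribution of the summand q^(12 T_l) of ψ(q^12) to the coefficient of q^(12 T_t) in A ψ(q^12).
product-term : ℕ → ℕ → ℤ
product-term t l = ((q ^S (12 * tri l)) ⊛ prodTo (suc (12 * tri t)) factorA) (12 * tri t)

shifted-prodTo : ∀ {k N} → k ≤ N → ((q ^S k) ⊛ prodTo (suc N) factorA) N ≡₂ infProdCoeff factorA (N ∸ k)
shifted-prodTo {k} {N} k≤N = ≡₂-trans (≡₂-reflexive (q^⊛-coefficient {k} {N} (prodTo (suc N) factorA) k≤N))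
  (prodTo-stable-≤ (ℕ.m≤n⇒m≤1+n (ℕ.m∸n≤m N k)))

product-term-∸ : ∀ {l t} → l ≤ t → product-term t l ≡₂ infProdCoeff factorA (12 * (tri t ∸ tri l))
product-term-∸ {l} {t} l≤t = ≡.subst (λ n → product-term t l ≡₂ infProdCoeff factorA n)
  (≡.sym (ℕ.*-distribˡ-∸ 12 (tri t) (tri l)))
  (shifted-prodTo {12 * tri l} {12 * tri t} (ℕ.*-monoʳ-≤ 12 (tri-mono-≤ l≤t)))

-- A summand q^(4 T_n) could contribute only if T_n = 3 T_t, that is n(n+1) = 3t(t+1), which the
-- hypothesis excludes.
theta₄-coefficient : ∀ t → (∀ l → l * (l + 1) ≢ 3 * t * (t + 1)) →
  ∀ n → ∑ℤ n (λ l → (q ^S (4 * tri l)) (12 * tri t)) ≡ 0ℤ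
theta₄-coefficient t non-triangular zero    = ≡.refl
theta₄-coefficient t non-triangular (suc n) = cong₂ ℤ._+_ (q^-≢ 4tri≢12tri) (theta₄-coefficient t non-triangular n)
  where
  open ≡.≡-Reasoning
  4tri≢12tri : 4 * tri n ≢ 12 * tri t
  4tri≢12tri e = non-triangular n (ℕ.*-cancelˡ-≡ _ _ 2 (begin
    2 * (n * (n + 1))        ≡⟨ cong (2 *_) (2*tri n) ⟨
    2 * (2 * tri n)          ≡⟨ ℕ.*-assoc 2 2 (tri n) ⟨
    4 * tri n                ≡⟨ e ⟩
    12 * tri t               ≡⟨ 12*tri t ⟩
    6 * t * (t + 1)          ≡⟨ cong (_* (t + 1)) (ℕ.*-assoc 2 3 t) ⟩
    2 * (3 * t) * (t + 1)    ≡⟨ ℕ.*-assoc 2 (3 * t) (t + 1) ⟩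
    2 * (3 * t * (t + 1))    ∎))

t≤tri : ∀ t → t ≤ tri t
t≤tri zero    = z≤n
t≤tri (suc t) = ℕ.m≤m+n (suc t) (tri t)

-- This is A ψ(q^12) ≡ ψ(q^4) at q^N. The summands of ψ(q^12) with l > t start beyond q^N and may be
-- dropped; `suc t ≤ 2 * suc N` makes the shorter sum an initial part of `theta 12`.
∑-shifted-product : ∀ N t → suc t ≤ 2 * suc N → (∀ l → suc t ≤ l → N < 12 * tri l) →
  ∑ℤ (suc t) (λ l → ((q ^S (12 * tri l)) ⊛ prodTo (suc N) factorA) N)
    ≡₂ ∑ℤ (2 * suc N) (λ l → (q ^S (4 * tri l)) N)
∑-shifted-product N t 1+t≤ N< = ∑-extract (suc t) (2 * suc N)
  (λ l → (q ^S (12 * tri l)) ⊛ P) (λ l → q ^S (4 * tri l)) (begin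
    ∑ (suc t) (λ l → (q ^S (12 * tri l)) ⊛ P)          ≈⟨ ∑-cong to-ring (suc t) ⟩
    ∑ (suc t) (λ l → P ⋆ q ^ (12 * tri l))             ≈⟨ *-distribˡ-∑ P (λ l → q ^ (12 * tri l)) (suc t) ⟨
    P ⋆ ∑ (suc t) (λ l → q ^ (12 * tri l))             ≈⟨ *-congˡ (∑-truncate (suc t) high (2 * suc N ∸ suc t)) ⟨
    P ⋆ ∑ (2 * suc N ∸ suc t + suc t) (λ l → q ^ (12 * tri l))
      ≡⟨ cong (λ n → P ⋆ ∑ n (λ l → q ^ (12 * tri l))) (ℕ.m∸n+n≡m 1+t≤) ⟩
    P ⋆ theta 12                                       ≈⟨ prodTo*theta₁₂ ⟩
    theta 4                                            ≈⟨ ∑-cong (λ l → reflexive (^S≡^ q (4 * tri l))) (2 * suc N) ⟨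
    ∑ (2 * suc N) (λ l → q ^S (4 * tri l))             ∎)
  where
  P = prodTo (suc N) factorA
  open Truncated N
  open Theta N using (theta; prodTo*theta₁₂)
  open Relation.Binary.Reasoning.Setoid setoid

  to-ring : ∀ l → (q ^S (12 * tri l)) ⊛ P ≈ P ⋆ q ^ (12 * tri l)
  to-ring l = begin
    (q ^S (12 * tri l)) ⊛ P    ≡⟨ ⋆≡⊛ (q ^S (12 * tri l)) P ⟨
    (q ^S (12 * tri l)) ⋆ P    ≈⟨ *-comm (q ^S (12 * tri l)) P ⟩
    P ⋆ (q ^S (12 * tri l))    ≡⟨ cong (P ⋆_) (^S≡^ q (12 * tri l)) ⟩
    P ⋆ q ^ (12 * tri l)       ∎

  high : ∀ l → suc t ≤ l → q ^ (12 * tri l) ≈ zeroS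
  high l t<l = trans (reflexive (≡.sym (^S≡^ q (12 * tri l)))) (q^-vanish (N< l t<l))

∑-product-term : ∀ t → (∀ l → l * (l + 1) ≢ 3 * t * (t + 1)) → ∑ℤ (suc t) (product-term t) ≡₂ 0ℤ
∑-product-term t non-triangular = ≡₂-trans (∑-shifted-product N t 1+t≤ N<)
  (≡₂-reflexive (theta₄-coefficient t non-triangular (2 * suc N)))
  where
  N = 12 * tri t

  1+t≤ : suc t ≤ 2 * suc N
  1+t≤ = ℕ.≤-trans (s≤s (ℕ.≤-trans (t≤tri t) (ℕ.m≤n*m (tri t) 12))) (ℕ.m≤n*m (suc N) 2)

  N< : ∀ l → suc t ≤ l → N < 12 * tri l
  N< l t<l = ℕ.*-monoʳ-< 12 (ℕ.<-≤-trans (ℕ.m<n+m (tri t) (s≤s z≤n)) (tri-mono-≤ t<l))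

∑-proper-product-term : ∀ t → (∀ l → l * (l + 1) ≢ 3 * t * (t + 1)) → ∑ℤ t (product-term t) ≡₂ 1ℤ
∑-proper-product-term t non-triangular = ≡₂-trans (≡₂-sym (1+[1+a]≡₂a s))
  (+-cong₂ {1ℤ} ≡₂-refl (≡₂-trans (+-cong₂ (≡₂-sym top) ≡₂-refl) (∑-product-term t non-triangular)))
  where
  s = ∑ℤ t (product-term t)
  top : product-term t t ≡₂ 1ℤ
  -- For l = t the index is `12 * 0`, where the empty product gives the coefficient 1.
  top = ≡.subst (λ d → product-term t t ≡₂ infProdCoeff factorA (12 * d)) (ℕ.n∸n≡0 (tri t))
    (product-term-∸ (ℕ.≤-refl {t}))

-- Odd and even terms of an odd sum.

∃-odd-term : ∀ g n → ∑ℤ n g ≡₂ 1ℤ → ∃ λ l → l < n × g l ≡₂ 1ℤ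
∃-odd-term g zero    sum≡1 = contradiction sum≡1 0≢₂1
∃-odd-term g (suc n) sum≡1 with parity (g n)
... | inj₂ gn≡1 = n , ℕ.≤-refl , gn≡1
... | inj₁ gn≡0 with ∃-odd-term g n (≡₂-trans (≡₂-reflexive (≡.sym (ℤ.+-identityˡ (∑ℤ n g))))
                       (≡₂-trans (+-cong₂ (≡₂-sym gn≡0) ≡₂-refl) sum≡1))
...   | l , l<n , gl≡1 = l , ℕ.m≤n⇒m≤1+n l<n , gl≡1

-- An even number of odd terms has even sum. The recursion removes terms in pairs: two odd ones
-- cancel modulo 2, so the rest still has odd sum.
∃-even-term : ∀ g n → ∑ℤ (2 * n) g ≡₂ 1ℤ → ∃ λ l → l < 2 * n × g l ≡₂ 0ℤ
∃-even-term g zero    sum≡1 = contradiction sum≡1 0≢₂1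
∃-even-term g (suc n) sum≡1 = ≡.subst (λ m → ∃ λ l → l < m × g l ≡₂ 0ℤ) (≡.sym (ℕ.*-suc 2 n))
  (pair (parity (g (1 + 2 * n))) (parity (g (2 * n))))
  where
  s = ∑ℤ (2 * n) g
  sum≡1′ : g (1 + 2 * n) ℤ.+ (g (2 * n) ℤ.+ s) ≡₂ 1ℤ
  sum≡1′ = ≡.subst (λ m → ∑ℤ m g ≡₂ 1ℤ) (ℕ.*-suc 2 n) sum≡1

  pair : g (1 + 2 * n) ≡₂ 0ℤ ⊎ g (1 + 2 * n) ≡₂ 1ℤ → g (2 * n) ≡₂ 0ℤ ⊎ g (2 * n) ≡₂ 1ℤ →
    ∃ λ l → l < 2 + 2 * n × g l ≡₂ 0ℤ
  pair (inj₁ e) _        = 1 + 2 * n , ℕ.≤-refl , e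
  pair (inj₂ _) (inj₁ e) = 2 * n , ℕ.m≤n⇒m≤1+n ℕ.≤-refl , e
  pair (inj₂ d) (inj₂ e) with ∃-even-term g n (≡₂-trans (≡₂-sym (1+[1+a]≡₂a s))
                                (≡₂-trans (+-cong₂ (≡₂-sym d) (+-cong₂ (≡₂-sym e) ≡₂-refl)) sum≡1′))
  ... | l , l<2n , gl≡0 = l , ℕ.m≤n⇒m≤1+n (ℕ.m≤n⇒m≤1+n l<2n) , gl≡0

-- The exponents 12d - 1 and their interval.

12*d∸1%4 : ∀ d → 1 ≤ d → (12 * d ∸ 1) % 4 ≡ 3
12*d∸1%4 (suc d) _ = begin
  (12 * suc d ∸ 1) % 4       ≡⟨ cong (λ m → (m ∸ 1) % 4) (ℕ.*-suc 12 d) ⟩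
  (11 + 12 * d) % 4          ≡⟨ cong (λ m → (11 + m) % 4) (≡.trans (ℕ.*-comm 12 d) (≡.sym (ℕ.*-assoc d 3 4))) ⟩
  (11 + d * 3 * 4) % 4       ≡⟨ ℕ.[m+kn]%n≡m%n 11 (d * 3) 4 ⟩
  3                          ∎
  where open ≡.≡-Reasoning

a3+-pred : ∀ {m} → 1 ≤ m → a3+ (+ (m ∸ 1)) ≡₂ infProdCoeff factorA m
a3+-pred {m} 1≤m = ≡₂-reflexive (≡.trans (a3+-shift (m ∸ 1)) (cong (infProdCoeff factorA) (ℕ.m∸n+n≡m 1≤m)))
  where
  a3+-shift : ∀ n → a3+ (+ n) ≡ infProdCoeff factorA (n + 1)
  a3+-shift n = ≡.refl

-- One form for both parts: (a) is the case t with residue 1, (b) the case 2t with residue 0, since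
-- 12 · 2t = 24t and 6 · 2t (2t+1) = 12t(2t+1).
Exponent : ℕ → ℤ → Set
Exponent t a = Σ ℕ λ n → 12 * t ∸ 1 ≤ n × n ≤ 6 * t * (t + 1) ∸ 1 × n % 4 ≡ 3 × a3+ (+ n) ≡₂ a

exponent : ∀ t d {a} → 1 ≤ t → t ≤ d → d ≤ tri t → infProdCoeff factorA (12 * d) ≡₂ a → Exponent t a
exponent t d 1≤t t≤d d≤tri coefficient≡a =
    12 * d ∸ 1
  , ℕ.∸-monoˡ-≤ 1 (ℕ.*-monoʳ-≤ 12 t≤d)
  , ℕ.∸-monoˡ-≤ 1 (ℕ.≤-trans (ℕ.*-monoʳ-≤ 12 d≤tri) (ℕ.≤-reflexive (12*tri t)))
  , 12*d∸1%4 d 1≤d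
  , ≡₂-trans (a3+-pred {12 * d} (ℕ.≤-trans 1≤d (ℕ.m≤n*m d 12))) coefficient≡a
  where
  1≤d : 1 ≤ d
  1≤d = ℕ.≤-trans 1≤t t≤d

term-exponent : ∀ {t l a} → 1 ≤ t → l < t → product-term t l ≡₂ a → Exponent t a
term-exponent {t} {l} 1≤t l<t term≡a = exponent t (tri t ∸ tri l) 1≤t (t≤tri[t]∸tri[l] l<t) (ℕ.m∸n≤m (tri t) (tri l))
  (≡₂-trans (≡₂-sym (product-term-∸ {l} {t} (ℕ.<⇒≤ l<t))) term≡a)

odd-exponent : ∀ t → 1 ≤ t → (∀ l → l * (l + 1) ≢ 3 * t * (t + 1)) → Exponent t 1ℤ
odd-exponent t 1≤t non-triangular =
  let l , l<t , odd = ∃-odd-term (product-term t) t (∑-proper-product-term t non-triangular)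
  in term-exponent {t} {l} 1≤t l<t odd

even-exponent : ∀ t → 1 ≤ t → (∀ l → l * (l + 1) ≢ 6 * t * (2 * t + 1)) → Exponent (2 * t) 0ℤ
even-exponent t 1≤t non-triangular =
  let l , l<2t , even = ∃-even-term (product-term (2 * t)) t (∑-proper-product-term (2 * t) non-triangular′)
  in term-exponent {2 * t} {l} (ℕ.≤-trans 1≤t (ℕ.m≤n*m t 2)) l<2t even
  where
  non-triangular′ : ∀ l → l * (l + 1) ≢ 3 * (2 * t) * (2 * t + 1)
  non-triangular′ l e = non-triangular l (≡.trans e (cong (_* (2 * t + 1)) (≡.sym (ℕ.*-assoc 3 2 t))))

-- Parity of the coefficients of j₃⁺.

even⇒2∣ : ∀ {a} → a ≡₂ 0ℤ → + 2 ∣ a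
even⇒2∣ {a} (mod2 p) = Signed.∣⇒∣ᵤ (≡.subst (Signed._∣_ (+ 2)) (ℤ.+-identityʳ a) p)

odd⇒2∤ : ∀ {a} → a ≡₂ 1ℤ → ¬ (+ 2 ∣ a)
odd⇒2∤ {a} odd 2∣a = 0≢₂1 (≡₂-trans (≡₂-sym
  (mod2 (≡.subst (Signed._∣_ (+ 2)) (≡.sym (ℤ.+-identityʳ a)) (Signed.∣ᵤ⇒∣ 2∣a)))) odd)

-- The first and the last product in the convolution are both f(0) f(m+2) and cancel modulo 2.
-- Descending by two in this way proves f(q)^2 ≡ f(q^2), coefficient by coefficient.
⊛-square-suc² : ∀ f m → (f ⊛ f) (2 + m) ≡₂ (tail f ⊛ tail f) m
⊛-square-suc² f m = begin
  (f ⊛ f) (2 + m)                                            ≡⟨ ⊛-suc f f (suc m) ⟩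
  f 0 ℤ.* f (2 + m) ℤ.+ (tail f ⊛ f) (suc m)
    ≡⟨ cong (ℤ._+_ (f 0 ℤ.* f (2 + m))) (⊛-sucʳ (tail f) f m) ⟩
  f 0 ℤ.* f (2 + m) ℤ.+ (f (2 + m) ℤ.* f 0 ℤ.+ (tail f ⊛ tail f) m)
    ≡⟨ regroup (f 0) (f (2 + m)) ((tail f ⊛ tail f) m) ⟩
  (f 0 ℤ.* f (2 + m) ℤ.+ f 0 ℤ.* f (2 + m)) ℤ.+ (tail f ⊛ tail f) m
    ≈⟨ +-cong₂ (a+a≡₂0 (f 0 ℤ.* f (2 + m))) ≡₂-refl ⟩
  0ℤ ℤ.+ (tail f ⊛ tail f) m                                 ≡⟨ ℤ.+-identityˡ _ ⟩
  (tail f ⊛ tail f) m                                        ∎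
  where
  open Relation.Binary.Reasoning.Setoid ≡₂-setoid
  regroup : ∀ a b x → a ℤ.* b ℤ.+ (b ℤ.* a ℤ.+ x) ≡ (a ℤ.* b ℤ.+ a ℤ.* b) ℤ.+ x
  regroup = ℤ.solve-∀

⊛-square-even : ∀ m f → (f ⊛ f) (2 * m) ≡₂ f m
⊛-square-even zero    f = ≡₂-trans (≡₂-reflexive (⊛-zero f f)) (a²≡₂a (f 0))
⊛-square-even (suc m) f = ≡.subst (λ n → (f ⊛ f) n ≡₂ f (suc m)) (≡.sym (ℕ.*-suc 2 m))
  (≡₂-trans (⊛-square-suc² f (2 * m)) (⊛-square-even m (tail f)))

⊛-square-odd : ∀ m f → (f ⊛ f) (1 + 2 * m) ≡₂ 0ℤ
⊛-square-odd zero    f = begin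
  (f ⊛ f) 1                                ≡⟨ ⊛-suc f f 0 ⟩
  f 0 ℤ.* f 1 ℤ.+ (tail f ⊛ f) 0           ≡⟨ cong (ℤ._+_ (f 0 ℤ.* f 1)) (⊛-zero (tail f) f) ⟩
  f 0 ℤ.* f 1 ℤ.+ f 1 ℤ.* f 0              ≡⟨ cong (ℤ._+_ (f 0 ℤ.* f 1)) (ℤ.*-comm (f 1) (f 0)) ⟩
  f 0 ℤ.* f 1 ℤ.+ f 0 ℤ.* f 1              ≈⟨ a+a≡₂0 (f 0 ℤ.* f 1) ⟩
  0ℤ                                       ∎
  where open Relation.Binary.Reasoning.Setoid ≡₂-setoid
⊛-square-odd (suc m) f = ≡.subst (λ n → (f ⊛ f) (1 + n) ≡₂ 0ℤ) (≡.sym (ℕ.*-suc 2 m))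
  (≡₂-trans (⊛-square-suc² f (1 + 2 * m)) (⊛-square-odd m (tail f)))

module FourthPower (N : ℕ) where
  open Truncated N
  open Relation.Binary.Reasoning.Setoid setoid

  ^4≈⊛ : ∀ f → f ^ 4 ≈ (f ⊛ f) ⊛ (f ⊛ f)
  ^4≈⊛ f = begin
    f ^ 4                 ≈⟨ ^-homo-* f 2 2 ⟩
    f ^ 2 ⋆ f ^ 2         ≈⟨ *-cong f²≈f⋆f f²≈f⋆f ⟩
    (f ⋆ f) ⋆ (f ⋆ f)     ≡⟨ ⋆≡⊛ (f ⋆ f) (f ⋆ f) ⟩
    (f ⋆ f) ⊛ (f ⋆ f)     ≡⟨ cong (λ g → g ⊛ g) (⋆≡⊛ f f) ⟩
    (f ⊛ f) ⊛ (f ⊛ f)     ∎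
    where
    f²≈f⋆f : f ^ 2 ≈ f ⋆ f
    f²≈f⋆f = *-congˡ (*-identityʳ f)

  root : ℕ → Series
  root k = oneMinusQ (3 * k) ^ 3 ⋆ geom k ^ 3

  factorB≈root⁴ : ∀ k → factorB k ≈ root k ^ 4
  factorB≈root⁴ k = begin
    factorB k                                            ≡⟨ factorB≡ k ⟩
    oneMinusQ (3 * k) ^ 12 ⋆ geom k ^ 12                 ≈⟨ *-cong (^-assocʳ (oneMinusQ (3 * k)) 3 4) (^-assocʳ (geom k) 3 4) ⟨
    (oneMinusQ (3 * k) ^ 3) ^ 4 ⋆ (geom k ^ 3) ^ 4       ≈⟨ ^-distrib-* (oneMinusQ (3 * k) ^ 3) (geom k ^ 3) 4 ⟨
    root k ^ 4                                           ∎

  rootProduct : Series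
  rootProduct = ∏ N root

  prodTo-factorB : prodTo N factorB ≈ (rootProduct ⊛ rootProduct) ⊛ (rootProduct ⊛ rootProduct)
  prodTo-factorB = begin
    prodTo N factorB           ≡⟨ prodTo≡∏ N factorB ⟩
    ∏ N factorB                ≈⟨ ∏-cong {factorB} {λ k → root k ^ 4} (λ k → factorB≈root⁴ (suc k)) N ⟩
    ∏ N (λ k → root k ^ 4)     ≈⟨ ∏-^ root 4 N ⟩
    rootProduct ^ 4            ≈⟨ ^4≈⊛ rootProduct ⟩
    (rootProduct ⊛ rootProduct) ⊛ (rootProduct ⊛ rootProduct) ∎

⊛-fourth-power-even : ∀ f k → ((f ⊛ f) ⊛ (f ⊛ f)) (2 * (1 + 2 * k)) ≡₂ 0ℤ
⊛-fourth-power-even f k = ≡₂-trans (⊛-square-even (1 + 2 * k) (f ⊛ f)) (⊛-square-odd k f)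

infProdCoeff-factorB-even : ∀ k → infProdCoeff factorB (2 * (1 + 2 * k)) ≡₂ 0ℤ
infProdCoeff-factorB-even k = ≡₂-trans
  (_≈[_]_.coefficient (FourthPower.prodTo-factorB (2 * (1 + 2 * k))) (2 * (1 + 2 * k)) ℕ.≤-refl)
  (⊛-fourth-power-even (FourthPower.rootProduct (2 * (1 + 2 * k))) k)

-- For n = 4k + 3 the factor q in front of the product moves the index to n - 1 = 2(1 + 2k), which
-- is not a multiple of 4; a fourth power has an even coefficient there.
b3+-even : ∀ n → n % 4 ≡ 3 → b3+ (+ n) ≡₂ 0ℤ
b3+-even n n%4≡3 = ≡.subst (λ n → b3+ (+ n) ≡₂ 0ℤ) (≡.sym n≡)
  (b3+-suc (2 * (1 + 2 * (n ℕ./ 4))) (infProdCoeff-factorB-even (n ℕ./ 4)))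
  where
  open ℕ.+-*-Solver
  n≡ : n ≡ suc (2 * (1 + 2 * (n ℕ./ 4)))
  n≡ = ≡.trans (ℕ.m≡m%n+[m/n]*n n 4) (≡.trans (cong (_+ n ℕ./ 4 * 4) n%4≡3)
    (solve 1 (λ k → con 3 :+ k :* con 4 := con 1 :+ con 2 :* (con 1 :+ con 2 :* k)) ≡.refl (n ℕ./ 4)))
  b3+-suc : ∀ m → infProdCoeff factorB m ≡₂ 0ℤ → b3+ (+ suc m) ≡₂ 0ℤ
  b3+-suc m even = even

c3+≡₂a3+ : ∀ n → n % 4 ≡ 3 → c3+ (+ n) ≡₂ a3+ (+ n)
c3+≡₂a3+ n n%4≡3 = absorb (a3+ (+ n)) (const12 (+ n)) (b3+ (+ n)) (const12-even n) (b3+-even n n%4≡3)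
  where
  const12-even : ∀ n → const12 (+ n) ≡₂ 0ℤ
  const12-even zero    = mod2 (Signed.divides (+ 6) ≡.refl)
  const12-even (suc _) = ≡₂-refl

  absorb : ∀ a c b → c ≡₂ 0ℤ → b ≡₂ 0ℤ → a ℤ.+ c ℤ.+ + 729 ℤ.* b ≡₂ a
  absorb a c b c≡0 b≡0 = ≡₂-trans
    (+-cong₂ (+-cong₂ (≡₂-refl {a}) c≡0) (*-cong₂ (≡₂-refl {+ 729}) b≡0))
    (≡₂-reflexive (≡.trans (ℤ.+-identityʳ (a ℤ.+ 0ℤ)) (ℤ.+-identityʳ a)))

-- An obstruction modulo 5 and the unbounded families.

l*[l+1]%5≢3 : ∀ l → (l * (l + 1)) % 5 ≢ 3
-- The residues of l(l+1) for l = 0, ..., 4 are 0, 2, 1, 2, 0, and they repeat with period 5.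
l*[l+1]%5≢3 0 ()
l*[l+1]%5≢3 1 ()
l*[l+1]%5≢3 2 ()
l*[l+1]%5≢3 3 ()
l*[l+1]%5≢3 4 ()
l*[l+1]%5≢3 (suc (suc (suc (suc (suc l))))) e = l*[l+1]%5≢3 l (≡.trans (≡.sym
  (≡.trans (cong (_% 5) (solve 1 (λ l → (con 5 :+ l) :* (con 5 :+ l :+ con 1)
      := l :* (l :+ con 1) :+ (con 2 :* l :+ con 6) :* con 5) ≡.refl l))
    (ℕ.[m+kn]%n≡m%n (l * (l + 1)) (2 * l + 6) 5))) e)
  where open ℕ.+-*-Solver

l*[l+1]≢3+5k : ∀ {n} k → n ≡ 3 + k * 5 → ∀ l → l * (l + 1) ≢ n
l*[l+1]≢3+5k k n≡ l e = l*[l+1]%5≢3 l (≡.trans (cong (_% 5) (≡.trans e n≡)) (ℕ.[m+kn]%n≡m%n 3 k 5))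

t≡2[5]⇒non-triangular : ∀ N → let t = 2 + 5 * N in ∀ l → l * (l + 1) ≢ 3 * t * (t + 1)
t≡2[5]⇒non-triangular N = l*[l+1]≢3+5k (3 + 15 * N + 15 * (N * N))
  (solve 1 (λ N → let t = con 2 :+ con 5 :* N in con 3 :* t :* (t :+ con 1)
     := con 3 :+ (con 3 :+ con 15 :* N :+ con 15 :* (N :* N)) :* con 5) ≡.refl N)
  where open ℕ.+-*-Solver

-- Part (b) is applied at 2t = 2 + 10N, again 2 modulo 5, so 6t(2t+1) ≡ 18 ≡ 3.
t≡1[5]⇒non-triangular : ∀ N → let t = 1 + 5 * N in ∀ l → l * (l + 1) ≢ 6 * t * (2 * t + 1)
t≡1[5]⇒non-triangular N = l*[l+1]≢3+5k (3 + 30 * N + 60 * (N * N))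
  (solve 1 (λ N → let t = con 1 :+ con 5 :* N in con 6 :* t :* (con 2 :* t :+ con 1)
     := con 3 :+ (con 3 :+ con 30 :* N :+ con 60 :* (N :* N)) :* con 5) ≡.refl N)
  where open ℕ.+-*-Solver

theorem3p1 : ((t : ℕ) → 1 ≤ t → ((l : ℕ) → l * (l + 1) ≢ 3 * t * (t + 1)) →
    Σ ℕ (λ n → (12 * t ∸ 1 ≤ n) × (n ≤ 6 * t * (t + 1) ∸ 1) × (n % 4 ≡ 3) × ¬ ((+ 2) ∣ a3+ (+ n))))
    × ((t : ℕ) → 1 ≤ t → ((l : ℕ) → l * (l + 1) ≢ 6 * t * (2 * t + 1)) →
    Σ ℕ (λ n → (24 * t ∸ 1 ≤ n) × (n ≤ 12 * t * (2 * t + 1) ∸ 1) × (n % 4 ≡ 3) × ((+ 2) ∣ a3+ (+ n))))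
    × ((N : ℕ) → Σ ℕ (λ n → (N ≤ n) × (n % 4 ≡ 3) × ((+ 2) ∣ c3+ (+ n))))
    × ((N : ℕ) → Σ ℕ (λ n → (N ≤ n) × (n % 4 ≡ 3) × ¬ ((+ 2) ∣ c3+ (+ n))))
theorem3p1 = odd-a3+ , even-a3+ , even-c3+ , odd-c3+
  where
  odd-a3+ : (t : ℕ) → 1 ≤ t → ((l : ℕ) → l * (l + 1) ≢ 3 * t * (t + 1)) →
    Σ ℕ (λ n → (12 * t ∸ 1 ≤ n) × (n ≤ 6 * t * (t + 1) ∸ 1) × (n % 4 ≡ 3) × ¬ ((+ 2) ∣ a3+ (+ n)))
  odd-a3+ t 1≤t non-triangular =
    let n , lower , upper , n%4≡3 , odd = odd-exponent t 1≤t non-triangular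
    in n , lower , upper , n%4≡3 , odd⇒2∤ odd

  even-a3+ : (t : ℕ) → 1 ≤ t → ((l : ℕ) → l * (l + 1) ≢ 6 * t * (2 * t + 1)) →
    Σ ℕ (λ n → (24 * t ∸ 1 ≤ n) × (n ≤ 12 * t * (2 * t + 1) ∸ 1) × (n % 4 ≡ 3) × ((+ 2) ∣ a3+ (+ n)))
  even-a3+ t 1≤t non-triangular =
    let n , lower , upper , n%4≡3 , even = even-exponent t 1≤t non-triangular
    in n
     , ≡.subst (λ k → k ∸ 1 ≤ n) (≡.sym (ℕ.*-assoc 12 2 t)) lower
     , ≡.subst (λ k → n ≤ k * (2 * t + 1) ∸ 1) (≡.sym (ℕ.*-assoc 6 2 t)) upper
     , n%4≡3 , even⇒2∣ even

  even-c3+ : (N : ℕ) → Σ ℕ (λ n → (N ≤ n) × (n % 4 ≡ 3) × ((+ 2) ∣ c3+ (+ n)))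
  even-c3+ N =
    let n , lower , _ , n%4≡3 , even = even-exponent (1 + 5 * N) (s≤s z≤n) (t≡1[5]⇒non-triangular N)
    in n , ℕ.≤-trans N≤24t∸1 lower , n%4≡3 , even⇒2∣ (≡₂-trans (c3+≡₂a3+ n n%4≡3) even)
    where
    N≤24t∸1 : N ≤ 12 * (2 * (1 + 5 * N)) ∸ 1
    -- The right side reduces to a sum beginning with `5 * N`, the subtraction of 1 having cancelled
    -- against a successor.
    N≤24t∸1 = ℕ.≤-trans (ℕ.m≤n*m N 5) (ℕ.≤-trans (ℕ.m≤m+n (5 * N) _) (ℕ.m≤m+n (5 * N + 1 * (1 + 5 * N)) _))

  odd-c3+ : (N : ℕ) → Σ ℕ (λ n → (N ≤ n) × (n % 4 ≡ 3) × ¬ ((+ 2) ∣ c3+ (+ n)))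
  odd-c3+ N =
    let n , lower , _ , n%4≡3 , odd = odd-exponent (2 + 5 * N) (s≤s z≤n) (t≡2[5]⇒non-triangular N)
    in n , ℕ.≤-trans N≤12t∸1 lower , n%4≡3 , odd⇒2∤ (≡₂-trans (c3+≡₂a3+ n n%4≡3) odd)
    where
    N≤12t∸1 : N ≤ 12 * (2 + 5 * N) ∸ 1
    N≤12t∸1 = ℕ.≤-trans (ℕ.m≤n*m N 5) (ℕ.≤-trans (ℕ.n≤1+n (5 * N)) (ℕ.m≤m+n (1 + 5 * N) _))
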